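{- Let $p$ be a prime with $p\equiv 1\pmod 4$ and let $\lambda$ be an integer with $p\nmid\lambda$. Let $a(p):=\#X_\lambda^4(\mathbb F_p)-p^2-1$ be the trace of Frobenius of the Dwork K3 surface $X_\lambda^4$ over $\mathbb F_p$ (with $\lambda$ reduced modulo $p$). Then $$a(p)\equiv \sum_{j=0}^{p-1}\frac{(\tfrac14)_j(\tfrac24)_j(\tfrac34)_j}{j!^3}\,\lambda^{ -4j}\pmod p,$$ i.e. $a(p)$ is congruent modulo $p$ to the truncation at $p$ of the period $\pi={}_{3}F_{2}\left(\frac14,\frac24,\frac34;1,1\,\middle|\,\frac{1}{\lambda^4}\right)=\sum_{j\ge0}\frac{(\frac14)_j(\frac24)_j(\frac34)_j}{j!^3}\lambda^{ -4j}$ of the surface.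
   Context: $X_\lambda^4$ is the Dwork K3 surface in $\mathbb P^3$ defined by $x_1^4+x_2^4+x_3^4+x_4^4=4\lambda x_1x_2x_3x_4$; $\#X_\lambda^4(\mathbb F_p)$ is its number of $\mathbb F_p$-rational points. $(a)_0=1$ and $(a)_j=a(a+1)\cdots(a+j-1)$. The congruence is in $\mathbb Z_{(p)}$ (the coefficients of the truncated sum are $p$-integral). -}

module Defs where

open import Algebra.Definitions.RawSemiring using () renaming (_^_ to power)
open import Data.Fin.Base using (Fin; toℕ)
open import Data.Fin.Properties using (any?)
open import Data.Integer.Base as ℤ using (ℤ; +_; 0ℤ)
open import Data.Integer.Divisibility.Signed using (_∣_; _∣?_; divides)
open import Data.Integer.GCD using (gcd)
import Data.Integer.Properties as ℤ
open import Data.List.Base using (List; [_]; map; filter; foldr; length; allFin; upTo; deduplicate; cartesianProductWith)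
open import Data.Nat.Base as ℕ using (ℕ; zero; suc; _!)
import Data.Nat.Divisibility as ℕ
import Data.Nat.Properties as ℕ
open import Data.Product.Base using (∃-syntax; _×_)
open import Data.Rational.Base as ℚ using (ℚ; 0ℚ; 1ℚ; _/_; _÷_; 1/_; ↥_; ↧ₙ_)
import Data.Rational.Properties as ℚ
open import Data.Vec.Base using (Vec; []; _∷_)
open import Data.Vec.Relation.Unary.All using (All; all?)
open import Data.Vec.Relation.Binary.Pointwise.Inductive using (Pointwise; decidable)
open import Relation.Binary.Definitions using (Decidable)
open import Relation.Binary.PropositionalEquality using (_≡_; sym; trans; cong)
open import Relation.Nullary using (¬_)
open import Relation.Nullary.Decidable using (¬?; _×-dec_)
open import Relation.Unary as U using ()

infix 4 _≡_[modℤ_] _≡_[modℤ₍_₎] _∈ℤ₍_₎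

_≡_[modℤ_] : ℤ → ℤ → ℕ → Set
x ≡ y [modℤ p ] = + p ∣ x ℤ.- y

-- The field 𝔽_p is represented by Fin p through the residues 0, …, p - 1;
-- equations in 𝔽_p are congruences modulo p between these residues.
module _ (p : ℕ) where

  private
    𝔽 : Set
    𝔽 = Fin p

  res : 𝔽 → ℤ
  res x = + toℕ x

  IsZero : 𝔽 → Set
  IsZero x = res x ≡ 0ℤ

  isZero? : U.Decidable IsZero
  isZero? x = res x ℤ.≟ 0ℤ

  NonZeroVec : ∀ {n} → Vec 𝔽 n → Set
  NonZeroVec v = ¬ All IsZero v

  nonZeroVec? : ∀ {n} → U.Decidable (NonZeroVec {n})
  nonZeroVec? v = ¬? (all? isZero? v)

  -- v ∼ w on nonzero vectors: v and w are the same point of projective space.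
  _∼_ : ∀ {n} → Vec 𝔽 n → Vec 𝔽 n → Set
  v ∼ w = ∃[ c ] (¬ IsZero c) × Pointwise (λ x y → res y ≡ res c ℤ.* res x [modℤ p ]) v w

  _∼?_ : ∀ {n} → Decidable (_∼_ {n})
  v ∼? w = any? λ c → ¬? (isZero? c) ×-dec decidable (λ x y → + p ∣? (res y ℤ.- res c ℤ.* res x)) v w

  allVecs : ∀ n → List (Vec 𝔽 n)
  allVecs zero    = [ [] ]
  allVecs (suc n) = cartesianProductWith _∷_ (allFin p) (allVecs n)

  module _ (λ′ : ℤ) where

    OnDwork : Vec 𝔽 4 → Set
    OnDwork (x₁ ∷ x₂ ∷ x₃ ∷ x₄ ∷ []) =
      res x₁ ℤ.^ 4 ℤ.+ res x₂ ℤ.^ 4 ℤ.+ res x₃ ℤ.^ 4 ℤ.+ res x₄ ℤ.^ 4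
        ≡ + 4 ℤ.* λ′ ℤ.* res x₁ ℤ.* res x₂ ℤ.* res x₃ ℤ.* res x₄ [modℤ p ]

    onDwork? : U.Decidable OnDwork
    onDwork? (x₁ ∷ x₂ ∷ x₃ ∷ x₄ ∷ []) = + p ∣? _

    -- Deduplicating the nonzero solutions modulo ∼ keeps exactly one
    -- representative of each projective point.
    DworkPoints : List (Vec 𝔽 4)
    DworkPoints = deduplicate _∼?_ (filter onDwork? (filter nonZeroVec? (allVecs 4)))

    #Dwork : ℕ
    #Dwork = length DworkPoints

    frobeniusTrace : ℤ
    frobeniusTrace = + #Dwork ℤ.- + (p ℕ.^ 2) ℤ.- + 1

fromℤ : ℤ → ℚ
fromℤ z = z / 1

fromℤ-nonZero : ∀ z → .{{ℤ.NonZero z}} → ℚ.NonZero (fromℤ z)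
fromℤ-nonZero z = ℚ.≢-nonZero {fromℤ z} λ z/1≡0 → ℕ.≢-nonZero⁻¹ ℤ.∣ z ∣ (cong ℤ.∣_∣
  (trans (sym (ℚ.↥-/ z 1)) (cong (λ q → ↥ q ℤ.* gcd z (+ 1)) z/1≡0)))

∤⇒nonZero : ∀ {p z} → ¬ (+ p ∣ z) → ℤ.NonZero z
∤⇒nonZero {p} p∤z = ℤ.≢-nonZero λ z≡0 → p∤z (divides 0ℤ z≡0)

infixr 8 _^_

_^_ : ℚ → ℕ → ℚ
_^_ = power ℚ.+-*-rawSemiring

-- (a)_j = a (a + 1) ⋯ (a + j - 1)
pochhammer : ℚ → ℕ → ℚ
pochhammer a zero    = 1ℚ
pochhammer a (suc j) = pochhammer a j ℚ.* (a ℚ.+ fromℤ (+ j))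

module _ (λ′ : ℤ) .{{λ≢0 : ℤ.NonZero λ′}} where

  periodTerm : ℕ → ℚ
  periodTerm j =
    (pochhammer (+ 1 / 4) j ℚ.* pochhammer (+ 2 / 4) j ℚ.* pochhammer (+ 3 / 4) j)
      ÷ fromℤ (+ ((j !) ℕ.^ 3))
      ℚ.* (1/ fromℤ λ′) ^ (4 ℕ.* j)
    where instance
      _ = ℕ.m^n≢0 (j !) 3 {{j ℕ.!≢0}}
      _ = fromℤ-nonZero (+ ((j !) ℕ.^ 3))
      _ = fromℤ-nonZero λ′

  truncatedPeriod : ℕ → ℚ
  truncatedPeriod n = foldr ℚ._+_ 0ℚ (map periodTerm (upTo n))

-- Membership in the localisation ℤ₍ₚ₎; ↧ₙ is the denominator in lowest terms.
_∈ℤ₍_₎ : ℚ → ℕ → Set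
q ∈ℤ₍ p ₎ = ¬ (p ℕ.∣ ↧ₙ q)

-- x - y ∈ p ℤ₍ₚ₎
_≡_[modℤ₍_₎] : ℚ → ℚ → ℕ → Set
x ≡ y [modℤ₍ p ₎] = ∃[ q ] q ∈ℤ₍ p ₎ × x ℚ.- y ≡ fromℤ (+ p) ℚ.* q

{-# OPTIONS --safe #-}
module Submission where

-- Let n = p - 1 and let F be the quartic form of the surface. Removing the zero vector and grouping the remaining
-- affine zeros of F into lines of n vectors gives a(p) ≡ - #{F = 0} modulo p, and by Fermat the indicator function
-- of F = 0 is 1 - Fⁿ, so a(p) ≡ Σ F(x)ⁿ over x ∈ 𝔽ₚ⁴. Expand Fⁿ by the multinomial theorem. A power sum Σ xᵉ over
-- 𝔽ₚ vanishes for e < n, while the four exponents of every monomial add up to 4n, so only the monomial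
-- (x₁x₂x₃x₄)ⁿ survives. Its coefficient is Σₖ n! / (k!⁴ (n-4k)!) (-4λ)ⁿ⁻⁴ᵏ, whose terms are congruent to
-- (4k)! / (k!⁴ 4⁴ᵏ) λ⁻⁴ᵏ = (1/4)ₖ (2/4)ₖ (3/4)ₖ / k!³ λ⁻⁴ᵏ.

open import Defs hiding (_^_)
open import Algebra.Bundles using (CommutativeRing)
import Algebra.Properties.CommutativeSemiring.Exp as Exp
open import Data.Fin.Base using (Fin; toℕ; fromℕ<)
import Data.Fin.Properties as Fin
open import Data.Integer.Base as ℤ using (ℤ; +_; 0ℤ; 1ℤ; _+_; _*_; _-_; -_; _^_)
open import Data.Integer.Divisibility.Signed using (_∣_; _∣?_; divides; ∣m∣n⇒∣m+n; ∣m⇒∣-m; ∣n⇒∣m*n; ∣m⇒∣m*n; ∣⇒∣ᵤ; ∣ᵤ⇒∣)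
import Data.Integer.DivMod as ℤ
import Data.Integer.Properties as ℤ
open import Data.Integer.Tactic.RingSolver using (solve-∀)
open import Data.List.Base using (List; []; _∷_; [_]; _++_; map; foldr; length; upTo; applyUpTo; allFin; tabulate; cartesianProductWith; filter; deduplicate)
import Data.List.Properties as List
open import Data.List.Membership.Propositional using (_∈_; find; lose)
open import Data.List.Membership.Propositional.Properties using (∈-upTo⁻; ∈-cartesianProductWith⁺; ∈-filter⁻; ∈-allFin; ∈-deduplicate⁻)
import Data.List.Relation.Unary.All as ListAll
open import Data.List.Relation.Unary.AllPairs using (AllPairs; []; _∷_)
open import Data.List.Relation.Unary.Any using (here; there)
import Data.List.Relation.Unary.Any.Properties as Any
open import Data.List.Relation.Unary.Unique.DecSetoid.Properties using (deduplicate-!)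
open import Data.List.Relation.Unary.Unique.Propositional using (Unique)
import Data.List.Relation.Unary.Unique.Propositional.Properties as Unique
open import Data.Nat.Base as ℕ using (ℕ; zero; suc; _≤_; _<_; z≤n; s≤s; _∸_; _!; _%_)
open import Data.Nat.Combinatorics using (_C_; nCk+nC[k+1]≡[n+1]C[k+1]; k>n⇒nCk≡0; nCk≡n!/k![n-k]!; k![n∸k]!∣n!; nCn≡1)
import Data.Nat.Coprimality as Coprimality
open import Data.Nat.DivMod using (m/n*n≡m)
import Data.Nat.Divisibility as ℕ
open import Data.Nat.Induction using (<-rec)
open import Data.Nat.Primality using (Prime; euclidsLemma; prime⇒nonTrivial; ¬prime[0]; ¬prime[1])
import Data.Nat.Properties as ℕ
import Data.Nat.Tactic.RingSolver as ℕSolver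
open import Data.Product.Base using (_×_; _,_; proj₁; proj₂; ∃-syntax)
open import Data.Rational.Base as ℚ using (ℚ; 0ℚ; 1ℚ; _/_; 1/_; mkℚ; toℚᵘ)
import Data.Rational.Properties as ℚ
open import Data.Rational.Solver using (module +-*-Solver)
open import Data.Rational.Unnormalised.Base using (mkℚᵘ; *≡*) renaming (_≃_ to _≃ᵘ_; _+_ to _+ᵘ_; _*_ to _*ᵘ_)
import Data.Rational.Unnormalised.Properties as ℚᵘ
open import Data.Sum.Base as Sum using (_⊎_; inj₁; inj₂; [_,_]′)
open import Data.Vec.Base as Vec using (Vec; []; _∷_; sum; replicate)
import Data.Vec.Properties as Vec
open import Data.Vec.Relation.Binary.Pointwise.Inductive using (Pointwise; []; _∷_; decidable)
open import Data.Vec.Relation.Unary.All as All using (All; []; _∷_)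
open import Function.Base using (_∘_; id)
open import Level using (Level; 0ℓ)
open import Relation.Binary.Bundles using (Setoid; DecSetoid)
open import Relation.Binary.Core using (Rel)
open import Relation.Binary.PropositionalEquality using (_≡_; _≢_; refl; sym; trans; cong; cong₂; subst; module ≡-Reasoning)
import Relation.Binary.Reasoning.Setoid as SetoidReasoning
open import Relation.Nullary using (¬_; Dec; yes; no; contradiction)
open import Relation.Nullary.Decidable using (¬?; map′)
open import Relation.Unary as U using (Pred)

-- The form has as many variables as its degree. A multi-index `ks` with `sum ks ≤ n` selects the
-- exponents `4k + (n - sum ks)`, whose total is 4n whatever `ks` is, so the demand that no exponent
-- fall below n leaves no slack. With c = -4λ, two congruences link the surviving coefficient to the
-- period: n ≡ -1 gives n!/(n-4k)! ≡ (4k)!, and Fermat gives cⁿ⁻⁴ᵏ ≡ c⁻⁴ᵏ. Both sides thus become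
-- the single fraction (4k)! / (k!⁴ c⁴ᵏ). Such statements are multiplied through by the denominator,
-- a unit modulo p for k < p. The truncated period runs over all k < p, while the expansion only has
-- terms with 4k ≤ n. For the other k the coefficient is 0 and (4k)! is divisible by p, so no
-- correction term appears. Projective points are given as a deduplicated list, so lines are counted
-- by summing the indicator of `r ∼ v` over representatives r and solutions v: each r meets n ≡ -1
-- solutions, each v exactly one representative.

private
  variable
    a ℓ : Level
    A B D : Set a
    m : ℕ

-- Finite sums

∑ : List A → (A → ℤ) → ℤ
∑ []       f = 0ℤ
∑ (x ∷ xs) f = f x + ∑ xs f

syntax ∑ xs (λ x → e) = ∑[ x ← xs ] e

infixr 7 ∑

∑-cong : ∀ {f g : A → ℤ} xs → (∀ {x} → x ∈ xs → f x ≡ g x) → ∑ xs f ≡ ∑ xs g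
∑-cong []       eq = refl
∑-cong (x ∷ xs) eq = cong₂ _+_ (eq (here refl)) (∑-cong xs (eq ∘ there))

∑-+ : ∀ (xs : List A) f g → ∑[ x ← xs ] (f x + g x) ≡ ∑ xs f + ∑ xs g
∑-+ []       f g = refl
∑-+ (x ∷ xs) f g = trans (cong (λ s → f x + g x + s) (∑-+ xs f g)) (interchange (f x) (g x) (∑ xs f) (∑ xs g))
  where
  interchange : ∀ a b c d → a + b + (c + d) ≡ a + c + (b + d)
  interchange = solve-∀

∑-*ˡ : ∀ (xs : List A) c f → ∑[ x ← xs ] (c * f x) ≡ c * ∑ xs f
∑-*ˡ []       c f = sym (ℤ.*-zeroʳ c)
∑-*ˡ (x ∷ xs) c f = trans (cong (λ s → c * f x + s) (∑-*ˡ xs c f)) (sym (ℤ.*-distribˡ-+ c (f x) (∑ xs f)))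

∑-*ʳ : ∀ (xs : List A) f c → ∑[ x ← xs ] (f x * c) ≡ ∑ xs f * c
∑-*ʳ xs f c = trans (∑-cong xs (λ {x} _ → ℤ.*-comm (f x) c)) (trans (∑-*ˡ xs c f) (ℤ.*-comm c _))

∑-const : ∀ (xs : List A) c → ∑[ _ ← xs ] c ≡ + length xs * c
∑-const []       c = refl
∑-const (x ∷ xs) c = trans (cong (λ s → c + s) (∑-const xs c)) (sym (ℤ.suc-* (+ length xs) c))

∑-zero : ∀ {f} (xs : List A) → (∀ {x} → x ∈ xs → f x ≡ 0ℤ) → ∑ xs f ≡ 0ℤ
∑-zero xs eq = trans (∑-cong xs eq) (trans (∑-const xs 0ℤ) (ℤ.*-zeroʳ (+ length xs)))

∑-swap : ∀ (xs : List A) (ys : List B) (f : A → B → ℤ) →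
  ∑[ x ← xs ] ∑[ y ← ys ] f x y ≡ ∑[ y ← ys ] ∑[ x ← xs ] f x y
∑-swap []       ys f = sym (∑-zero ys (λ _ → refl))
∑-swap (x ∷ xs) ys f = trans (cong (λ s → ∑ ys (f x) + s) (∑-swap xs ys f))
  (sym (∑-+ ys (f x) (λ y → ∑[ x ← xs ] f x y)))

∑-++ : ∀ (xs ys : List A) f → ∑ (xs ++ ys) f ≡ ∑ xs f + ∑ ys f
∑-++ []       ys f = sym (ℤ.+-identityˡ _)
∑-++ (x ∷ xs) ys f = trans (cong (λ s → f x + s) (∑-++ xs ys f)) (sym (ℤ.+-assoc (f x) _ _))

∑-map : ∀ (g : A → B) xs f → ∑ (map g xs) f ≡ ∑ xs (f ∘ g)
∑-map g []       f = refl
∑-map g (x ∷ xs) f = cong (λ s → f (g x) + s) (∑-map g xs f)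

∑-cartesianProductWith : ∀ (g : A → B → D) xs ys f →
  ∑ (cartesianProductWith g xs ys) f ≡ ∑[ x ← xs ] ∑[ y ← ys ] f (g x y)
∑-cartesianProductWith g []       ys f = refl
∑-cartesianProductWith g (x ∷ xs) ys f = trans (∑-++ (map (g x) ys) _ f)
  (cong₂ _+_ (∑-map (g x) ys f) (∑-cartesianProductWith g xs ys f))

∑-applyUpTo : ∀ (g : ℕ → A) n f → ∑ (applyUpTo g n) f ≡ ∑ (upTo n) (f ∘ g)
∑-applyUpTo g n f = trans (cong (λ xs → ∑ xs f) (sym (List.map-upTo g n))) (∑-map g (upTo n) f)

∑-first : ∀ n f → ∑ (upTo (suc n)) f ≡ f 0 + ∑ (upTo n) (f ∘ suc)
∑-first n f = cong (λ s → f 0 + s) (∑-applyUpTo suc n f)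

∑-last : ∀ n f → ∑ (upTo (suc n)) f ≡ ∑ (upTo n) f + f n
∑-last n f = trans (cong (λ xs → ∑ xs f) (sym (List.upTo-∷ʳ n)))
  (trans (∑-++ (upTo n) _ f) (cong (λ s → ∑ (upTo n) f + s) (ℤ.+-identityʳ (f n))))

∑-tabulate : ∀ n (g : Fin n → A) f h → (∀ i → f (g i) ≡ h (toℕ i)) → ∑ (tabulate g) f ≡ ∑ (upTo n) h
∑-tabulate zero    g f h eq = refl
∑-tabulate (suc n) g f h eq = trans
  (cong₂ _+_ (eq Fin.zero) (∑-tabulate n (g ∘ Fin.suc) f (h ∘ suc) (eq ∘ Fin.suc)))
  (sym (∑-first n h))

∑-telescope : ∀ n (f : ℕ → ℤ) → ∑[ i ← upTo n ] (f (suc i) - f i) ≡ f n - f 0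
∑-telescope zero    f = sym (ℤ.+-inverseʳ (f 0))
∑-telescope (suc n) f = trans (∑-first n (λ i → f (suc i) - f i))
  (trans (cong (λ s → f 1 - f 0 + s) (∑-telescope n (f ∘ suc))) (lemma (f 0) (f 1) (f (suc n))))
  where
  lemma : ∀ a b c → b - a + (c - b) ≡ c - a
  lemma = solve-∀

𝟙 : {P : Set ℓ} → Dec P → ℤ
𝟙 (yes _) = 1ℤ
𝟙 (no  _) = 0ℤ

∑-filter : ∀ {P : Pred A ℓ} (P? : U.Decidable P) xs f → ∑ (filter P? xs) f ≡ ∑[ x ← xs ] (𝟙 (P? x) * f x)
∑-filter P? []       f = refl
∑-filter P? (x ∷ xs) f with P? x
... | yes _ = cong₂ _+_ (sym (ℤ.*-identityˡ (f x))) (∑-filter P? xs f)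
... | no  _ = trans (∑-filter P? xs f) (sym (ℤ.+-identityˡ _))

-- The range is padded to an arbitrary bound `N ≥ n`, the extra binomial coefficients being zero.
-- When the theorem is iterated over several summands, all indices can then run through one common
-- box, although the exponents left over shrink.
binomialTheorem : ∀ n N → n ≤ N → ∀ a b →
  (a + b) ^ n ≡ ∑[ k ← upTo (suc N) ] (+ (n C k) * (a ^ k * b ^ (n ∸ k)))
binomialTheorem zero    N n≤N a b = sym (trans (∑-first N (λ k → + (0 C k) * (a ^ k * b ^ (0 ∸ k))))
  (cong (λ s → 1ℤ + s) (∑-zero (upTo N) (λ {k} _ → cong (λ c → + c * (a ^ suc k * b ^ 0)) (k>n⇒nCk≡0 {0} {suc k} (s≤s z≤n))))))
binomialTheorem (suc n) (suc N) (s≤s n≤N) a b = begin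
  (a + b) * (a + b) ^ n
    ≡⟨ ℤ.*-distribʳ-+ ((a + b) ^ n) a b ⟩
  a * (a + b) ^ n + b * (a + b) ^ n
    -- The second copy is padded one further, so that after its first term is split off both sums
    -- have the same range and Pascal's rule applies termwise.
    ≡⟨ cong₂ (λ s t → a * s + b * t) (binomialTheorem n N n≤N a b) (binomialTheorem n (suc N) (ℕ.m≤n⇒m≤1+n n≤N) a b) ⟩
  a * (∑[ k ← upTo (suc N) ] t k) + b * (∑[ k ← upTo (suc (suc N)) ] t k)
    ≡⟨ cong (λ s → a * (∑[ k ← upTo (suc N) ] t k) + s) (trans (cong (b *_) (∑-first (suc N) t)) (ℤ.*-distribˡ-+ b (t 0) _)) ⟩
  a * (∑[ k ← upTo (suc N) ] t k) + (b * t 0 + b * (∑[ k ← upTo (suc N) ] t (suc k)))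
    ≡⟨ cong₂ (λ x y → x + (b * t 0 + y)) (sym (∑-*ˡ (upTo (suc N)) a t)) (sym (∑-*ˡ (upTo (suc N)) b (t ∘ suc))) ⟩
  (∑[ k ← upTo (suc N) ] (a * t k)) + (b * t 0 + (∑[ k ← upTo (suc N) ] (b * t (suc k))))
    ≡⟨ rearrange (∑[ k ← upTo (suc N) ] (a * t k)) (b * t 0) (∑[ k ← upTo (suc N) ] (b * t (suc k))) ⟩
  b * t 0 + ((∑[ k ← upTo (suc N) ] (a * t k)) + (∑[ k ← upTo (suc N) ] (b * t (suc k))))
    ≡⟨ cong₂ _+_ first (sym (∑-+ (upTo (suc N)) (λ k → a * t k) (λ k → b * t (suc k)))) ⟩
  u 0 + ∑[ k ← upTo (suc N) ] (a * t k + b * t (suc k))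
    ≡⟨ cong (λ s → u 0 + s) (∑-cong (upTo (suc N)) (λ {k} _ → pascal k)) ⟩
  u 0 + ∑[ k ← upTo (suc N) ] u (suc k)
    ≡⟨ ∑-first (suc N) u ⟨
  ∑ (upTo (suc (suc N))) u ∎
  where
  open ≡-Reasoning
  t u : ℕ → ℤ
  t k = + (n C k) * (a ^ k * b ^ (n ∸ k))
  u k = + (suc n C k) * (a ^ k * b ^ (suc n ∸ k))
  rearrange : ∀ x y z → x + (y + z) ≡ y + (x + z)
  rearrange = solve-∀
  first : b * t 0 ≡ u 0
  first = lemma b (b ^ n)
    where
    lemma : ∀ b c → b * (1ℤ * (1ℤ * c)) ≡ 1ℤ * (1ℤ * (b * c))
    lemma = solve-∀
  shift : ∀ k → b * t (suc k) ≡ + (n C suc k) * (a ^ suc k * b ^ (n ∸ k))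
  shift k with k ℕ.<? n
  ... | yes k<n rewrite ℕ.+-∸-assoc 1 k<n = lemma (+ (n C suc k)) (a ^ suc k) b (b ^ (n ∸ suc k))
    where
    lemma : ∀ c x b y → b * (c * (x * y)) ≡ c * (x * (b * y))
    lemma = solve-∀
  -- Here both truncated exponents are 0 and do not differ by one, but the coefficient vanishes.
  ... | no k≮n rewrite k>n⇒nCk≡0 {n} {suc k} (s≤s (ℕ.≮⇒≥ k≮n)) = trans (cong (b *_) (ℤ.*-zeroˡ (a ^ suc k * b ^ (n ∸ suc k)))) (ℤ.*-zeroʳ b)
  pascal : ∀ k → a * t k + b * t (suc k) ≡ u (suc k)
  pascal k = trans (cong (λ s → a * t k + s) (shift k))
    (trans (lemma a (+ (n C k)) (+ (n C suc k)) (a ^ k) (b ^ (n ∸ k)))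
      (cong (λ c → c * (a ^ suc k * b ^ (n ∸ k))) (trans (sym (ℤ.pos-+ (n C k) (n C suc k))) (cong +_ (nCk+nC[k+1]≡[n+1]C[k+1] n k)))))
    where
    lemma : ∀ a c d x y → a * (c * (x * y)) + d * ((a * x) * y) ≡ (c + d) * ((a * x) * y)
    lemma = solve-∀

binomialTheorem-1 : ∀ m x → (x + 1ℤ) ^ m ≡ ∑[ k ← upTo (suc m) ] (+ (m C k) * x ^ k)
binomialTheorem-1 m x = trans (binomialTheorem m m ℕ.≤-refl x 1ℤ) (∑-cong (upTo (suc m)) (λ {k} _ →
  cong (+ (m C k) *_) (trans (cong (x ^ k *_) (ℤ.^-zeroˡ (m ∸ k))) (ℤ.*-identityʳ (x ^ k)))))

-- Congruences of integers modulo `p`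

module Modulo (p : ℕ) where

  infix 4 _≈_

  -- Wrapped in a record so that both sides can be inferred from a proof.
  record _≈_ (x y : ℤ) : Set where
    constructor mk
    field
      congruent : x ≡ y [modℤ p ]
  open _≈_ public

  ≡⇒≈ : ∀ {x y} → x ≡ y → x ≈ y
  ≡⇒≈ {x} refl = mk (divides 0ℤ (ℤ.+-inverseʳ x))

  ≈-refl : ∀ {x} → x ≈ x
  ≈-refl = ≡⇒≈ refl

  ≈-sym : ∀ {x y} → x ≈ y → y ≈ x
  ≈-sym {x} {y} (mk d) = mk (subst (+ p ∣_) (lemma x y) (∣m⇒∣-m d))
    where
    lemma : ∀ x y → - (x - y) ≡ y - x
    lemma = solve-∀

  ≈-trans : ∀ {x y z} → x ≈ y → y ≈ z → x ≈ z
  ≈-trans {x} {y} {z} (mk d) (mk e) = mk (subst (+ p ∣_) (lemma x y z) (∣m∣n⇒∣m+n d e))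
    where
    lemma : ∀ x y z → (x - y) + (y - z) ≡ x - z
    lemma = solve-∀

  +-cong : ∀ {x y u v} → x ≈ y → u ≈ v → x + u ≈ y + v
  +-cong {x} {y} {u} {v} (mk d) (mk e) = mk (subst (+ p ∣_) (lemma x y u v) (∣m∣n⇒∣m+n d e))
    where
    lemma : ∀ x y u v → (x - y) + (u - v) ≡ (x + u) - (y + v)
    lemma = solve-∀

  *-cong : ∀ {x y u v} → x ≈ y → u ≈ v → x * u ≈ y * v
  *-cong {x} {y} {u} {v} (mk d) (mk e) =
    mk (subst (+ p ∣_) (lemma x y u v) (∣m∣n⇒∣m+n (∣m⇒∣m*n u d) (∣n⇒∣m*n y e)))
    where
    lemma : ∀ x y u v → (x - y) * u + y * (u - v) ≡ x * u - y * v
    lemma = solve-∀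

  neg-cong : ∀ {x y} → x ≈ y → - x ≈ - y
  neg-cong {x} {y} (mk d) = mk (subst (+ p ∣_) (lemma x y) (∣m⇒∣-m d))
    where
    lemma : ∀ x y → - (x - y) ≡ - x - - y
    lemma = solve-∀

  ^-cong : ∀ {x y} n → x ≈ y → x ^ n ≈ y ^ n
  ^-cong zero    eq = ≈-refl
  ^-cong (suc n) eq = *-cong eq (^-cong n eq)

  ≈-setoid : Setoid _ _
  ≈-setoid = record
    { Carrier = ℤ
    ; _≈_ = _≈_
    ; isEquivalence = record { refl = ≈-refl ; sym = ≈-sym ; trans = ≈-trans }
    }

  module ≈-Reasoning = SetoidReasoning ≈-setoid

  ∣⇒≈0 : ∀ {x} → + p ∣ x → x ≈ 0ℤ
  ∣⇒≈0 {x} d = mk (subst (+ p ∣_) (sym (ℤ.+-identityʳ x)) d)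

  ≈0⇒∣ : ∀ {x} → x ≈ 0ℤ → + p ∣ x
  ≈0⇒∣ {x} (mk d) = subst (+ p ∣_) (ℤ.+-identityʳ x) d

  *-zeroˡ-≈ : ∀ {x} y → x ≈ 0ℤ → x * y ≈ 0ℤ
  *-zeroˡ-≈ y eq = ≈-trans (*-cong eq ≈-refl) (≡⇒≈ (ℤ.*-zeroˡ y))

  *-zeroʳ-≈ : ∀ x {y} → y ≈ 0ℤ → x * y ≈ 0ℤ
  *-zeroʳ-≈ x eq = ≈-trans (*-cong (≈-refl {x}) eq) (≡⇒≈ (ℤ.*-zeroʳ x))

  p≈0 : + p ≈ 0ℤ
  p≈0 = ∣⇒≈0 (divides 1ℤ (sym (ℤ.*-identityˡ (+ p))))

  ∑-cong-≈ : ∀ {f g : A → ℤ} xs → (∀ {x} → x ∈ xs → f x ≈ g x) → ∑ xs f ≈ ∑ xs g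
  ∑-cong-≈ []       eq = ≈-refl
  ∑-cong-≈ (x ∷ xs) eq = +-cong (eq (here refl)) (∑-cong-≈ xs (eq ∘ there))

  ∑-zero-≈ : ∀ {f : A → ℤ} xs → (∀ {x} → x ∈ xs → f x ≈ 0ℤ) → ∑ xs f ≈ 0ℤ
  ∑-zero-≈ xs eq = ≈-trans (∑-cong-≈ xs eq) (≡⇒≈ (∑-zero xs (λ _ → refl)))

  -- A general `AllPairs R` covers both duplicate-free lists and lists of pairwise inequivalent
  -- representatives. As `R` may fail to be symmetric, entries before and after `z` are related to
  -- it in different orders.
  ∑-single : ∀ {R : Rel A ℓ} {xs z} {f : A → ℤ} → AllPairs R xs → z ∈ xs →
    (∀ {y} → R z y ⊎ R y z → f y ≈ 0ℤ) → ∑ xs f ≈ f z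
  ∑-single {xs = x ∷ xs} {f = f} (px ∷ _) (here refl) off =
    ≈-trans (+-cong (≈-refl {f x}) (∑-zero-≈ xs (λ y∈ → off (inj₁ (ListAll.lookup px y∈))))) (≡⇒≈ (ℤ.+-identityʳ (f x)))
  ∑-single {z = z} {f = f} (px ∷ pxs) (there z∈) off =
    ≈-trans (+-cong (off (inj₂ (ListAll.lookup px z∈))) (∑-single pxs z∈ off)) (≡⇒≈ (ℤ.+-identityˡ (f z)))

-- Prime fields

nCk*k!*[n∸k]!≡n! : ∀ {n k} → k ≤ n → (n C k) ℕ.* (k ! ℕ.* (n ∸ k) !) ≡ n !
nCk*k!*[n∸k]!≡n! {n} {k} k≤n = trans (cong (ℕ._* (k ! ℕ.* (n ∸ k) !)) (nCk≡n!/k![n-k]! k≤n)) (m/n*n≡m (k![n∸k]!∣n! k≤n))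
  where instance _ = k ℕ.!* (n ∸ k) !≢0

n∸k≡1+[n∸1+k] : ∀ {n k} → k < n → n ∸ k ≡ suc (n ∸ suc k)
n∸k≡1+[n∸1+k] k<n = ℕ.+-∸-assoc 1 k<n

module PrimeField (n : ℕ) (p-prime : Prime (suc n)) where

  private
    p : ℕ
    p = suc n

  open Modulo p public

  1<p : 1 < p
  1<p = ℕ.nonTrivial⇒n>1 p {{prime⇒nonTrivial p-prime}}

  p∤1+k : ∀ {k} → k < n → ¬ + p ∣ + suc k
  p∤1+k k<n p∣1+k = ℕ.<⇒≱ (s≤s k<n) (ℕ.∣⇒≤ (∣⇒∣ᵤ p∣1+k))

  p∣x*y⇒p∣x⊎p∣y : ∀ x y → + p ∣ x * y → + p ∣ x ⊎ + p ∣ y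
  p∣x*y⇒p∣x⊎p∣y x y p∣xy =
    Sum.map ∣ᵤ⇒∣ ∣ᵤ⇒∣ (euclidsLemma _ _ p-prime (subst (p ℕ.∣_) (ℤ.abs-* x y) (∣⇒∣ᵤ p∣xy)))

  p∤x*y : ∀ {x y} → ¬ + p ∣ x → ¬ + p ∣ y → ¬ + p ∣ x * y
  p∤x*y {x} {y} p∤x p∤y = [ p∤x , p∤y ]′ ∘ p∣x*y⇒p∣x⊎p∣y x y

  p∤1 : ¬ + p ∣ 1ℤ
  p∤1 p∣1 = ℕ.<⇒≱ 1<p (ℕ.∣⇒≤ (∣⇒∣ᵤ p∣1))

  p∤x^k : ∀ {x} k → ¬ + p ∣ x → ¬ + p ∣ x ^ k
  p∤x^k zero    p∤x = p∤1
  p∤x^k (suc k) p∤x = p∤x*y p∤x (p∤x^k k p∤x)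

  p∤k! : ∀ {k} → k < p → ¬ + p ∣ + (k !)
  p∤k! {zero}  _         = p∤1
  p∤k! {suc k} (s≤s k<n) = subst (λ z → ¬ + p ∣ z) (sym (ℤ.pos-* (suc k) (k !)))
    (p∤x*y (p∤1+k k<n) (p∤k! (ℕ.m<n⇒m<1+n k<n)))

  *-cancelˡ-≈0 : ∀ c {x} → ¬ + p ∣ c → c * x ≈ 0ℤ → x ≈ 0ℤ
  *-cancelˡ-≈0 c {x} p∤c eq = [ (λ p∣c → contradiction p∣c p∤c) , ∣⇒≈0 ]′ (p∣x*y⇒p∣x⊎p∣y c x (≈0⇒∣ eq))

  *-cancelˡ-≈ : ∀ c {x y} → ¬ + p ∣ c → c * x ≈ c * y → x ≈ y
  *-cancelˡ-≈ c {x} {y} p∤c (mk d) = mk (≈0⇒∣ (*-cancelˡ-≈0 c p∤c (∣⇒≈0 (subst (+ p ∣_) (lemma c x y) d))))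
    where
    lemma : ∀ c x y → c * x - c * y ≡ c * (x - y)
    lemma = solve-∀

  -- `p` divides `p !` but neither of the two factorials in the denominator of the binomial
  -- coefficient.
  p∣pCk : ∀ {k} → k < n → + (p C suc k) ≈ 0ℤ
  p∣pCk {k} k<n = *-cancelˡ-≈0 (+ (suc k !) * + ((p ∸ suc k) !))
    (p∤x*y (p∤k! (s≤s k<n)) (p∤k! (s≤s (ℕ.m∸n≤m n k))))
    (∣⇒≈0 (subst (+ p ∣_) eq (divides (+ (n !)) (trans (cong +_ (ℕ.*-comm p (n !))) (ℤ.pos-* (n !) p)))))
    where
    eq : + (p !) ≡ + (suc k !) * + ((p ∸ suc k) !) * + (p C suc k)
    eq = begin
      + (p !) ≡⟨ cong +_ (nCk*k!*[n∸k]!≡n! {p} {suc k} (s≤s (ℕ.<⇒≤ k<n))) ⟨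
      + ((p C suc k) ℕ.* ((suc k !) ℕ.* ((p ∸ suc k) !))) ≡⟨ cong +_ (ℕ.*-comm (p C suc k) _) ⟩
      + ((suc k !) ℕ.* ((p ∸ suc k) !) ℕ.* (p C suc k)) ≡⟨ ℤ.pos-* ((suc k !) ℕ.* ((p ∸ suc k) !)) (p C suc k) ⟩
      + ((suc k !) ℕ.* ((p ∸ suc k) !)) * + (p C suc k) ≡⟨ cong (_* + (p C suc k)) (ℤ.pos-* (suc k !) ((p ∸ suc k) !)) ⟩
      + (suc k !) * + ((p ∸ suc k) !) * + (p C suc k) ∎
      where open ≡-Reasoning

  frobenius : ∀ x → (x + 1ℤ) ^ p ≈ x ^ p + 1ℤ
  frobenius x = begin
    (x + 1ℤ) ^ p                                                   ≡⟨ binomialTheorem-1 p x ⟩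
    ∑ (upTo (suc p)) t                                             ≡⟨ ∑-first p t ⟩
    t 0 + ∑ (upTo p) (t ∘ suc)                                     ≡⟨ cong (λ s → t 0 + s) (∑-last n (t ∘ suc)) ⟩
    t 0 + (∑ (upTo n) (t ∘ suc) + t p)                             ≈⟨ +-cong (≈-refl {t 0}) (+-cong middle (≈-refl {t p})) ⟩
    t 0 + (0ℤ + t p)                                               ≡⟨ cong (λ c → t 0 + (0ℤ + + c * x ^ p)) (nCn≡1 p) ⟩
    t 0 + (0ℤ + 1ℤ * x ^ p)                                        ≡⟨ lemma (x ^ p) ⟩
    x ^ p + 1ℤ                                                     ∎
    where
    open ≈-Reasoning
    t : ℕ → ℤ
    t k = + (p C k) * x ^ k
    middle : ∑ (upTo n) (t ∘ suc) ≈ 0ℤ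
    middle = ∑-zero-≈ (upTo n) (λ {k} k∈ → *-zeroˡ-≈ (x ^ suc k) (p∣pCk (∈-upTo⁻ k∈)))
    lemma : ∀ y → 1ℤ * 1ℤ + (0ℤ + 1ℤ * y) ≡ y + 1ℤ
    lemma = solve-∀

  residue : ∀ z → z ≈ + (z ℤ.%ℕ p)
  residue z = mk (divides (z ℤ./ℕ p) (trans (cong (_- + (z ℤ.%ℕ p)) (ℤ.a≡a%ℕn+[a/ℕn]*n z p)) (lemma (+ (z ℤ.%ℕ p)) (z ℤ./ℕ p * + p))))
    where
    lemma : ∀ a b → a + b - a ≡ b
    lemma = solve-∀

  -- After reduction to a natural residue, an induction in which `frobenius` passes from `k` to
  -- `k + 1`.
  x^p≈x : ∀ x → x ^ p ≈ x
  x^p≈x x = ≈-trans (^-cong p (residue x)) (≈-trans (go (x ℤ.%ℕ p)) (≈-sym (residue x)))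
    where
    suc≡ : ∀ k → + suc k ≡ + k + 1ℤ
    suc≡ k = trans (cong +_ (ℕ.+-comm 1 k)) (ℤ.pos-+ k 1)
    go : ∀ k → (+ k) ^ p ≈ + k
    go zero    = ≡⇒≈ refl
    go (suc k) = subst (λ z → z ^ p ≈ z) (sym (suc≡ k)) (≈-trans (frobenius (+ k)) (+-cong (go k) (≈-refl {1ℤ})))

  fermat : ∀ {x} → ¬ + p ∣ x → x ^ n ≈ 1ℤ
  fermat {x} p∤x = *-cancelˡ-≈ x p∤x (≈-trans (x^p≈x x) (≡⇒≈ (sym (ℤ.*-identityʳ x))))

  -- Since `0 ^ 0` is 1, `powerSum 0` equals `p` and vanishes modulo `p`; a variable absent from a
  -- monomial kills its sum just like one of low degree.
  powerSum : ℕ → ℤ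
  powerSum e = ∑[ x ← upTo p ] (+ x) ^ e

  -- Summing (x + 1)^(e+1) - x^(e+1) over x < p gives p^(e+1), and expresses
  -- (e + 1) powerSum e through the lower power sums.
  powerSum≈0 : ∀ e → e < n → powerSum e ≈ 0ℤ
  powerSum≈0 = <-rec _ step
    where
    step : ∀ e → (∀ {k} → k < e → k < n → powerSum k ≈ 0ℤ) → e < n → powerSum e ≈ 0ℤ
    step e rec e<n = *-cancelˡ-≈0 (+ suc e) (p∤1+k e<n) (begin
      + suc e * powerSum e
        ≡⟨ cong (λ c → + c * powerSum e) e+1≡ ⟩
      + (suc e C e) * powerSum e
        ≡⟨ ℤ.+-identityˡ _ ⟨
      0ℤ + + (suc e C e) * powerSum e
        ≈⟨ +-cong lower ≈-refl ⟨
      (∑[ k ← upTo e ] (+ (suc e C k) * powerSum k)) + + (suc e C e) * powerSum e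
        ≡⟨ ∑-last e (λ k → + (suc e C k) * powerSum k) ⟨
      ∑[ k ← upTo (suc e) ] (+ (suc e C k) * powerSum k)
        ≡⟨ ∑-cong (upTo (suc e)) (λ {k} _ → sym (∑-*ˡ (upTo p) (+ (suc e C k)) (λ x → (+ x) ^ k))) ⟩
      ∑[ k ← upTo (suc e) ] ∑[ x ← upTo p ] (+ (suc e C k) * (+ x) ^ k)
        ≡⟨ ∑-swap (upTo (suc e)) (upTo p) (λ k x → + (suc e C k) * (+ x) ^ k) ⟩
      ∑[ x ← upTo p ] ∑[ k ← upTo (suc e) ] (+ (suc e C k) * (+ x) ^ k)
        ≡⟨ ∑-cong (upTo p) (λ {x} _ → difference x) ⟨
      ∑[ x ← upTo p ] ((+ suc x) ^ suc e - (+ x) ^ suc e)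
        ≡⟨ ∑-telescope p (λ x → (+ x) ^ suc e) ⟩
      (+ p) ^ suc e - 0ℤ
        ≡⟨ ℤ.+-identityʳ _ ⟩
      + p * (+ p) ^ e
        ≈⟨ *-zeroˡ-≈ ((+ p) ^ e) p≈0 ⟩
      0ℤ ∎)
      where
      open ≈-Reasoning
      e+1≡ : suc e ≡ suc e C e
      e+1≡ = ℕ.*-cancelʳ-≡ (suc e) (suc e C e) (e !) {{e ℕ.!≢0}} (sym (trans
        (cong ((suc e C e) ℕ.*_) (trans (sym (ℕ.*-identityʳ (e !)))
          (cong (λ j → e ! ℕ.* j !) (sym (trans (n∸k≡1+[n∸1+k] (ℕ.n<1+n e)) (cong suc (ℕ.n∸n≡0 e)))))))
        (nCk*k!*[n∸k]!≡n! (ℕ.n≤1+n e))))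
      lower : ∑[ k ← upTo e ] (+ (suc e C k) * powerSum k) ≈ 0ℤ
      lower = ∑-zero-≈ (upTo e) (λ {k} k∈ → *-zeroʳ-≈ (+ (suc e C k)) (rec (∈-upTo⁻ k∈) (ℕ.<-trans (∈-upTo⁻ k∈) e<n)))
      difference : ∀ x → (+ suc x) ^ suc e - (+ x) ^ suc e ≡ ∑[ k ← upTo (suc e) ] (+ (suc e C k) * (+ x) ^ k)
      difference x = trans (cong (_- (+ x) ^ suc e) (trans (cong (_^ suc e) (trans (cong +_ (ℕ.+-comm 1 x)) (ℤ.pos-+ x 1)))
        (trans (binomialTheorem-1 (suc e) (+ x)) (trans (∑-last (suc e) t)
          (cong (λ c → ∑ (upTo (suc e)) t + + c * (+ x) ^ suc e) (nCn≡1 (suc e)))))))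
        (lemma (∑ (upTo (suc e)) t) ((+ x) ^ suc e))
        where
        t : ℕ → ℤ
        t k = + (suc e C k) * (+ x) ^ k
        lemma : ∀ s y → s + 1ℤ * y - y ≡ s
        lemma = solve-∀

  0^n≡0 : 0ℤ ^ n ≡ 0ℤ
  0^n≡0 = trans (cong (0ℤ ^_) (sym (ℕ.m+[n∸m]≡n (ℕ.s≤s⁻¹ 1<p)))) (ℤ.*-zeroˡ (0ℤ ^ (n ∸ 1)))

  -- The leading `0ℤ` is the contribution of the residue 0, split off from a sum over all residues
  -- in which each nonzero one counts 1.
  ∑-ones : 0ℤ + ∑[ _ ← upTo n ] 1ℤ ≈ - 1ℤ
  ∑-ones = begin
    0ℤ + ∑[ _ ← upTo n ] 1ℤ       ≡⟨ cong (λ s → 0ℤ + s) (∑-const (upTo n) 1ℤ) ⟩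
    0ℤ + + length (upTo n) * 1ℤ   ≡⟨ cong (λ l → 0ℤ + + l * 1ℤ) (List.length-upTo n) ⟩
    0ℤ + + n * 1ℤ                 ≡⟨ lemma (+ n) ⟩
    1ℤ + + n + - 1ℤ               ≈⟨ +-cong p≈0 (≈-refl { - 1ℤ}) ⟩
    0ℤ + - 1ℤ                     ≡⟨⟩
    - 1ℤ                          ∎
    where
    open ≈-Reasoning
    lemma : ∀ x → 0ℤ + x * 1ℤ ≡ 1ℤ + x + - 1ℤ
    lemma = solve-∀

  powerSum-n≈-1 : powerSum n ≈ - 1ℤ
  powerSum-n≈-1 = begin
    powerSum n                                       ≡⟨ ∑-first n (λ x → (+ x) ^ n) ⟩
    0ℤ ^ n + ∑[ x ← upTo n ] (+ suc x) ^ n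
      ≈⟨ +-cong (≡⇒≈ 0^n≡0) (∑-cong-≈ (upTo n) (λ x∈ → fermat (p∤1+k (∈-upTo⁻ x∈)))) ⟩
    0ℤ + ∑[ _ ← upTo n ] 1ℤ                          ≈⟨ ∑-ones ⟩
    - 1ℤ                                             ∎
    where open ≈-Reasoning

  -- n! / (n - j)! is the product of the residues n - i ≡ -(i + 1) for i < j.
  n!≈ : ∀ j → j ≤ n → + (n !) ≈ (- 1ℤ) ^ j * + (j !) * + ((n ∸ j) !)
  n!≈ zero    _   = ≡⇒≈ (lemma (+ (n !)))
    where
    lemma : ∀ x → x ≡ 1ℤ * 1ℤ * x
    lemma = solve-∀
  n!≈ (suc j) j<n = begin
    + (n !)
      ≈⟨ n!≈ j (ℕ.<⇒≤ j<n) ⟩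
    (- 1ℤ) ^ j * + (j !) * + ((n ∸ j) !)
      ≡⟨ cong ((- 1ℤ) ^ j * + (j !) *_) (trans (cong (λ i → + (i !)) (n∸k≡1+[n∸1+k] j<n)) (ℤ.pos-* (suc (n ∸ suc j)) ((n ∸ suc j) !))) ⟩
    (- 1ℤ) ^ j * + (j !) * (+ suc (n ∸ suc j) * + ((n ∸ suc j) !))
      ≈⟨ *-cong (≈-refl {(- 1ℤ) ^ j * + (j !)}) (*-cong n-j≈ ≈-refl) ⟩
    (- 1ℤ) ^ j * + (j !) * (- (+ suc j) * + ((n ∸ suc j) !))
      ≡⟨ lemma ((- 1ℤ) ^ j) (+ (j !)) (+ suc j) (+ ((n ∸ suc j) !)) ⟩
    (- 1ℤ) ^ suc j * (+ suc j * + (j !)) * + ((n ∸ suc j) !)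
      ≡⟨ cong (λ x → (- 1ℤ) ^ suc j * x * + ((n ∸ suc j) !)) (ℤ.pos-* (suc j) (j !)) ⟨
    (- 1ℤ) ^ suc j * + (suc j !) * + ((n ∸ suc j) !) ∎
    where
    open ≈-Reasoning
    lemma : ∀ s f i g → s * f * (- i * g) ≡ - 1ℤ * s * (i * f) * g
    lemma = solve-∀
    n-j≈ : + suc (n ∸ suc j) ≈ - (+ suc j)
    n-j≈ = mk (divides 1ℤ (trans (trans (lemma₁ (+ suc (n ∸ suc j)) (+ suc j))
      (trans (sym (ℤ.pos-+ (suc (n ∸ suc j)) (suc j))) (cong (+_ ∘ suc) (ℕ.m∸n+n≡m j<n)))) (sym (ℤ.*-identityˡ (+ p)))))
      where
      lemma₁ : ∀ a b → a - - b ≡ a + b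
      lemma₁ = solve-∀

-- Power sums of monomials

-- `allVecs` over an arbitrary list: the box serves for points, over `allFin p`, and for
-- multi-indices, over `upTo p`.
vecs : List A → ∀ m → List (Vec A m)
vecs xs zero    = [ [] ]
vecs xs (suc m) = cartesianProductWith _∷_ xs (vecs xs m)

vecs-unique : ∀ {xs : List A} → Unique xs → ∀ m → Unique (vecs xs m)
vecs-unique xs! zero    = ListAll.[] ∷ []
vecs-unique xs! (suc m) = Unique.cartesianProductWith⁺ _∷_ Vec.∷-injective xs! (vecs-unique xs! m)

vecs-complete : ∀ {xs : List A} {v : Vec A m} → All (_∈ xs) v → v ∈ vecs xs m
vecs-complete []         = here refl
vecs-complete (px ∷ pxs) = ∈-cartesianProductWith⁺ _∷_ px (vecs-complete pxs)

∑-vecs : ∀ (xs : List A) m f → ∑ (vecs xs (suc m)) f ≡ ∑[ x ← xs ] ∑[ v ← vecs xs m ] f (x ∷ v)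
∑-vecs xs m f = ∑-cartesianProductWith _∷_ xs (vecs xs m) f

∑ᵛ ∏ᵛ : Vec ℤ m → ℤ
∑ᵛ []       = 0ℤ
∑ᵛ (x ∷ xs) = x + ∑ᵛ xs
∏ᵛ []       = 1ℤ
∏ᵛ (x ∷ xs) = x * ∏ᵛ xs

-- Multinomial expansion

monomial : Vec ℤ m → Vec ℕ m → ℤ
monomial []       []       = 1ℤ
monomial (x ∷ xs) (k ∷ ks) = x ^ k * monomial xs ks

-- The coefficient `n! / (k₁! ⋯ kₘ! (n - Σ kᵢ)!)` as an iterated binomial. The remainder `n - Σ kᵢ`
-- is the exponent of one further summand outside the vector.
multinomial : ℕ → Vec ℕ m → ℕ
multinomial n []       = 1
multinomial n (k ∷ ks) = (n C k) ℕ.* multinomial (n ∸ k) ks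

-- Truncated subtraction is harmless here: multinomial n ks vanishes when sum ks > n.
multinomialTheorem : ∀ (xs : Vec ℤ m) t n N → n ≤ N →
  (∑ᵛ xs + t) ^ n ≡ ∑[ ks ← vecs (upTo (suc N)) m ] (+ multinomial n ks * (monomial xs ks * t ^ (n ∸ sum ks)))
multinomialTheorem [] t n N n≤N = trans (cong (_^ n) (ℤ.+-identityˡ t)) (lemma (t ^ n))
  where
  lemma : ∀ x → x ≡ 1ℤ * (1ℤ * x) + 0ℤ
  lemma = solve-∀
multinomialTheorem {m = suc m} (x ∷ xs) t n N n≤N = begin
  (x + ∑ᵛ xs + t) ^ n
    ≡⟨ cong (_^ n) (ℤ.+-assoc x (∑ᵛ xs) t) ⟩
  (x + (∑ᵛ xs + t)) ^ n
    ≡⟨ binomialTheorem n N n≤N x (∑ᵛ xs + t) ⟩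
  ∑[ k ← upTo (suc N) ] (+ (n C k) * (x ^ k * (∑ᵛ xs + t) ^ (n ∸ k)))
    ≡⟨ ∑-cong (upTo (suc N)) (λ {k} _ → inner k) ⟩
  ∑[ k ← upTo (suc N) ] ∑[ ks ← vecs (upTo (suc N)) m ] term (k ∷ ks)
    ≡⟨ ∑-vecs (upTo (suc N)) m term ⟨
  ∑ (vecs (upTo (suc N)) (suc m)) term ∎
  where
  open ≡-Reasoning
  term : Vec ℕ (suc m) → ℤ
  term ks = + multinomial n ks * (monomial (x ∷ xs) ks * t ^ (n ∸ sum ks))
  inner : ∀ k → + (n C k) * (x ^ k * (∑ᵛ xs + t) ^ (n ∸ k)) ≡ ∑[ ks ← vecs (upTo (suc N)) m ] term (k ∷ ks)
  inner k = begin
    + (n C k) * (x ^ k * (∑ᵛ xs + t) ^ (n ∸ k))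
      ≡⟨ ℤ.*-assoc (+ (n C k)) (x ^ k) _ ⟨
    + (n C k) * x ^ k * (∑ᵛ xs + t) ^ (n ∸ k)
      ≡⟨ cong (+ (n C k) * x ^ k *_) (multinomialTheorem xs t (n ∸ k) N (ℕ.≤-trans (ℕ.m∸n≤m n k) n≤N)) ⟩
    + (n C k) * x ^ k * (∑[ ks ← vecs (upTo (suc N)) m ] term′ ks)
      ≡⟨ ∑-*ˡ (vecs (upTo (suc N)) m) (+ (n C k) * x ^ k) term′ ⟨
    ∑[ ks ← vecs (upTo (suc N)) m ] (+ (n C k) * x ^ k * term′ ks)
      ≡⟨ ∑-cong (vecs (upTo (suc N)) m) (λ {ks} _ → regroup ks) ⟩
    ∑[ ks ← vecs (upTo (suc N)) m ] term (k ∷ ks) ∎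
    where
    term′ : Vec ℕ m → ℤ
    term′ ks = + multinomial (n ∸ k) ks * (monomial xs ks * t ^ (n ∸ k ∸ sum ks))
    regroup : ∀ ks → + (n C k) * x ^ k * term′ ks ≡ term (k ∷ ks)
    regroup ks = trans
      (lemma (+ (n C k)) (x ^ k) (+ multinomial (n ∸ k) ks) (monomial xs ks) (t ^ (n ∸ k ∸ sum ks)))
      (cong₂ (λ c j → c * (x ^ k * monomial xs ks * t ^ j))
        (sym (ℤ.pos-* (n C k) (multinomial (n ∸ k) ks))) (ℕ.∸-+-assoc n k (sum ks)))
      where
      lemma : ∀ c y d z w → c * y * (d * (z * w)) ≡ c * d * (y * z * w)
      lemma = solve-∀

-- Some entry exceeds what its predecessors leave of `n`, and the binomial coefficient at that place
-- is zero.
multinomial≡0 : ∀ n (ks : Vec ℕ m) → n < sum ks → multinomial n ks ≡ 0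
multinomial≡0 n (k ∷ ks) n<k+ks with n ℕ.<? k
... | yes n<k rewrite k>n⇒nCk≡0 n<k = refl
... | no  n≮k = trans (cong ((n C k) ℕ.*_) (multinomial≡0 (n ∸ k) ks
  (ℕ.+-cancelˡ-< k (n ∸ k) (sum ks) (subst (_< k ℕ.+ sum ks) (sym (ℕ.m+[n∸m]≡n (ℕ.≮⇒≥ n≮k))) n<k+ks)))) (ℕ.*-zeroʳ (n C k))

∏! : Vec ℕ m → ℕ
∏! []       = 1
∏! (k ∷ ks) = k ! ℕ.* ∏! ks

multinomial-! : ∀ n (ks : Vec ℕ m) → sum ks ≤ n → multinomial n ks ℕ.* ∏! ks ℕ.* (n ∸ sum ks) ! ≡ n !
multinomial-! n []       _     = ℕ.+-identityʳ (n !)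
multinomial-! n (k ∷ ks) k+ks≤n = begin
  (n C k) ℕ.* multinomial (n ∸ k) ks ℕ.* (k ! ℕ.* ∏! ks) ℕ.* (n ∸ (k ℕ.+ sum ks)) !
    ≡⟨ cong (λ j → (n C k) ℕ.* multinomial (n ∸ k) ks ℕ.* (k ! ℕ.* ∏! ks) ℕ.* j !) (sym (ℕ.∸-+-assoc n k (sum ks))) ⟩
  (n C k) ℕ.* multinomial (n ∸ k) ks ℕ.* (k ! ℕ.* ∏! ks) ℕ.* (n ∸ k ∸ sum ks) !
    ≡⟨ lemma (n C k) (multinomial (n ∸ k) ks) (k !) (∏! ks) ((n ∸ k ∸ sum ks) !) ⟩
  (n C k) ℕ.* (k ! ℕ.* (multinomial (n ∸ k) ks ℕ.* ∏! ks ℕ.* (n ∸ k ∸ sum ks) !))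
    ≡⟨ cong (λ j → (n C k) ℕ.* (k ! ℕ.* j)) (multinomial-! (n ∸ k) ks (ℕ.m+n≤o⇒m≤o∸n (sum ks) (subst (_≤ n) (ℕ.+-comm k (sum ks)) k+ks≤n))) ⟩
  (n C k) ℕ.* (k ! ℕ.* (n ∸ k) !)
    ≡⟨ nCk*k!*[n∸k]!≡n! (ℕ.m+n≤o⇒m≤o k k+ks≤n) ⟩
  n ! ∎
  where
  open ≡-Reasoning
  lemma : ∀ c d x y z → c ℕ.* d ℕ.* (x ℕ.* y) ℕ.* z ≡ c ℕ.* (x ℕ.* (d ℕ.* y ℕ.* z))
  lemma = ℕSolver.solve-∀

^-distribʳ-* : ∀ n x y → (x * y) ^ n ≡ x ^ n * y ^ n
^-distribʳ-* zero    x y = refl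
^-distribʳ-* (suc n) x y = trans (cong (x * y *_) (^-distribʳ-* n x y)) (lemma x y (x ^ n) (y ^ n))
  where
  lemma : ∀ x y a b → x * y * (a * b) ≡ x * a * (y * b)
  lemma = solve-∀

monomial-regroup : ∀ d (xs : Vec ℤ m) ks j →
  monomial (Vec.map (_^ d) xs) ks * ∏ᵛ xs ^ j ≡ monomial xs (Vec.map (λ k → d ℕ.* k ℕ.+ j) ks)
monomial-regroup d []       []       j = trans (ℤ.*-identityˡ _) (ℤ.^-zeroˡ j)
monomial-regroup d (x ∷ xs) (k ∷ ks) j = begin
  (x ^ d) ^ k * M * (x * ∏ᵛ xs) ^ j      ≡⟨ cong₂ (λ y z → y * M * z) (ℤ.^-*-assoc x d k) (^-distribʳ-* j x (∏ᵛ xs)) ⟩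
  x ^ (d ℕ.* k) * M * (x ^ j * ∏ᵛ xs ^ j) ≡⟨ lemma (x ^ (d ℕ.* k)) M (x ^ j) (∏ᵛ xs ^ j) ⟩
  x ^ (d ℕ.* k) * x ^ j * (M * ∏ᵛ xs ^ j) ≡⟨ cong₂ _*_ (ℤ.^-distribˡ-+-* x (d ℕ.* k) j) (sym (monomial-regroup d xs ks j)) ⟨
  x ^ (d ℕ.* k ℕ.+ j) * monomial xs (Vec.map (λ k → d ℕ.* k ℕ.+ j) ks) ∎
  where
  open ≡-Reasoning
  M = monomial (Vec.map (_^ d) xs) ks
  lemma : ∀ a b c d → a * b * (c * d) ≡ a * c * (b * d)
  lemma = solve-∀

sum-affine : ∀ d j (ks : Vec ℕ m) → sum (Vec.map (λ k → d ℕ.* k ℕ.+ j) ks) ≡ d ℕ.* sum ks ℕ.+ m ℕ.* j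
sum-affine d j []       = sym (trans (ℕ.+-identityʳ (d ℕ.* 0)) (ℕ.*-zeroʳ d))
sum-affine {m = suc m} d j (k ∷ ks) = trans (cong (d ℕ.* k ℕ.+ j ℕ.+_) (sum-affine d j ks)) (lemma d j k (sum ks) m)
  where
  lemma : ∀ d j k s m → d ℕ.* k ℕ.+ j ℕ.+ (d ℕ.* s ℕ.+ m ℕ.* j) ≡ d ℕ.* (k ℕ.+ s) ℕ.+ (j ℕ.+ m ℕ.* j)
  lemma = ℕSolver.solve-∀

sum-replicate : ∀ m k → sum (replicate m k) ≡ m ℕ.* k
sum-replicate zero    k = refl
sum-replicate (suc m) k = cong (k ℕ.+_) (sum-replicate m k)

sum-≥ : ∀ {n} {es : Vec ℕ m} → All (n ≤_) es → m ℕ.* n ≤ sum es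
sum-≥ []         = z≤n
sum-≥ (px ∷ pxs) = ℕ.+-mono-≤ px (sum-≥ pxs)

-- The other entries already use up their share of the sum, so none has room to exceed `n`.
all-≥∧sum-minimal⇒all-≡ : ∀ {n} {es : Vec ℕ m} → All (n ≤_) es → sum es ≡ m ℕ.* n → All (_≡ n) es
all-≥∧sum-minimal⇒all-≡ []                            eq = []
all-≥∧sum-minimal⇒all-≡ {m = suc m} {n} {e ∷ es} (n≤e ∷ n≤es) eq = e≡n ∷
  all-≥∧sum-minimal⇒all-≡ n≤es (ℕ.+-cancelˡ-≡ n (sum es) (m ℕ.* n) (subst (λ x → x ℕ.+ sum es ≡ n ℕ.+ m ℕ.* n) e≡n eq))
  where
  e≡n : e ≡ n
  e≡n = ℕ.≤-antisym (ℕ.+-cancelʳ-≤ (m ℕ.* n) e n (subst (e ℕ.+ m ℕ.* n ≤_) eq (ℕ.+-monoʳ-≤ e (sum-≥ n≤es)))) n≤e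

-- The slope `suc d` is positive, so equal exponents come from equal indices. `k` is the leading
-- entry of a multi-index and `ks` its tail.
affine-injective : ∀ d j n (k : ℕ) (ks : Vec ℕ m) → suc d ℕ.* k ℕ.+ j ≡ n →
  All (_≡ n) (Vec.map (λ k → suc d ℕ.* k ℕ.+ j) ks) → ks ≡ replicate m k
affine-injective d j n k []        eq []         = refl
affine-injective d j n k (k′ ∷ ks) eq (px ∷ pxs) = cong₂ _∷_
  (ℕ.*-cancelˡ-≡ k′ k (suc d) (ℕ.+-cancelʳ-≡ j (suc d ℕ.* k′) (suc d ℕ.* k) (trans px (sym eq))))
  (affine-injective d j n k ks eq pxs)

-- The n-th power of the form summed over affine space

module Hypersurface (n : ℕ) (p-prime : Prime (suc n)) where

  open PrimeField n p-prime

  private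
    p : ℕ
    p = suc n

  residues : Vec (Fin p) m → Vec ℤ m
  residues = Vec.map (res p)

  ∏powerSum : Vec ℕ m → ℤ
  ∏powerSum es = ∏ᵛ (Vec.map powerSum es)

  -- By distributivity, a sum over a box of a product of one-variable functions factors.
  ∑-monomial : ∀ (es : Vec ℕ m) → ∑[ v ← vecs (allFin p) m ] monomial (residues v) es ≡ ∏powerSum es
  ∑-monomial []       = refl
  ∑-monomial {m = suc m} (e ∷ es) = begin
    ∑[ v ← vecs (allFin p) (suc m) ] monomial (residues v) (e ∷ es)
      ≡⟨ ∑-vecs (allFin p) m (λ v → monomial (residues v) (e ∷ es)) ⟩
    ∑[ x ← allFin p ] ∑[ v ← vecs (allFin p) m ] (res p x ^ e * monomial (residues v) es)
      ≡⟨ ∑-cong (allFin p) (λ {x} _ → trans (∑-*ˡ (vecs (allFin p) m) (res p x ^ e) _) (cong (res p x ^ e *_) (∑-monomial es))) ⟩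
    ∑[ x ← allFin p ] (res p x ^ e * ∏powerSum es)
      ≡⟨ ∑-*ʳ (allFin p) (λ x → res p x ^ e) (∏powerSum es) ⟩
    (∑[ x ← allFin p ] res p x ^ e) * ∏powerSum es
      ≡⟨ cong (_* ∏powerSum es) (∑-tabulate p id (λ x → res p x ^ e) (λ x → (+ x) ^ e) (λ _ → refl)) ⟩
    powerSum e * ∏powerSum es ∎
    where open ≡-Reasoning

  ∏powerSum≈0 : ∀ (es : Vec ℕ m) → ¬ All (n ≤_) es → ∏powerSum es ≈ 0ℤ
  ∏powerSum≈0 []       ¬all = contradiction [] ¬all
  ∏powerSum≈0 (e ∷ es) ¬all with n ℕ.≤? e
  ... | yes n≤e = *-zeroʳ-≈ (powerSum e) (∏powerSum≈0 es (λ all → ¬all (n≤e ∷ all)))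
  ... | no  n≰e = *-zeroˡ-≈ (∏powerSum es) (powerSum≈0 e (ℕ.≰⇒> n≰e))

  ∏powerSum-n : ∀ {es : Vec ℕ m} → All (_≡ n) es → ∏powerSum es ≈ (- 1ℤ) ^ m
  ∏powerSum-n []            = ≈-refl
  ∏powerSum-n (refl ∷ pxs) = *-cong powerSum-n≈-1 (∏powerSum-n pxs)

  -- The Dwork family in m variables is the case d = m, c = - m λ.
  form : ℕ → ℤ → Vec ℤ m → ℤ
  form d c xs = ∑ᵛ (Vec.map (_^ d) xs) + c * ∏ᵛ xs

  -- The exponents in the term of `form d c xs ^ n` selected by `ks`: `d * k` from the pure powers
  -- and `n ∸ sum ks` from the power of `c * ∏ᵛ xs`.
  exponents : ∀ d → Vec ℕ m → Vec ℕ m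
  exponents d ks = Vec.map (λ k → d ℕ.* k ℕ.+ (n ∸ sum ks)) ks

  ∑-form^n : ∀ d c → ∑[ v ← vecs (allFin p) m ] form d c (residues v) ^ n ≡
    ∑[ ks ← vecs (upTo p) m ] (+ multinomial n ks * c ^ (n ∸ sum ks) * ∏powerSum (exponents d ks))
  ∑-form^n {m = m} d c = begin
    ∑[ v ← vecs (allFin p) m ] form d c (residues v) ^ n
      -- The product term `c * ∏ᵛ` takes the role of the distinguished summand `t`.
      ≡⟨ ∑-cong (vecs (allFin p) m) (λ {v} _ → trans (multinomialTheorem (Vec.map (_^ d) (residues v)) (c * ∏ᵛ (residues v)) n n ℕ.≤-refl)
           (∑-cong (vecs (upTo p) m) (λ {ks} _ → regroup (residues v) ks))) ⟩
    ∑[ v ← vecs (allFin p) m ] ∑[ ks ← vecs (upTo p) m ] (coefficient ks * monomial (residues v) (exponents d ks))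
      ≡⟨ ∑-swap (vecs (allFin p) m) (vecs (upTo p) m) (λ v ks → coefficient ks * monomial (residues v) (exponents d ks)) ⟩
    ∑[ ks ← vecs (upTo p) m ] ∑[ v ← vecs (allFin p) m ] (coefficient ks * monomial (residues v) (exponents d ks))
      ≡⟨ ∑-cong (vecs (upTo p) m) (λ {ks} _ → trans (∑-*ˡ (vecs (allFin p) m) (coefficient ks) _)
           (cong (coefficient ks *_) (∑-monomial (exponents d ks)))) ⟩
    ∑[ ks ← vecs (upTo p) m ] (coefficient ks * ∏powerSum (exponents d ks)) ∎
    where
    open ≡-Reasoning
    coefficient : Vec ℕ m → ℤ
    coefficient ks = + multinomial n ks * c ^ (n ∸ sum ks)
    regroup : ∀ xs ks → + multinomial n ks * (monomial (Vec.map (_^ d) xs) ks * (c * ∏ᵛ xs) ^ (n ∸ sum ks)) ≡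
      coefficient ks * monomial xs (exponents d ks)
    regroup xs ks = trans (cong (λ z → + multinomial n ks * (monomial (Vec.map (_^ d) xs) ks * z)) (^-distribʳ-* (n ∸ sum ks) c (∏ᵛ xs)))
      (trans (lemma (+ multinomial n ks) (monomial (Vec.map (_^ d) xs) ks) (c ^ (n ∸ sum ks)) (∏ᵛ xs ^ (n ∸ sum ks)))
        (cong (coefficient ks *_) (monomial-regroup d xs ks (n ∸ sum ks))))
      where
      lemma : ∀ a b c d → a * (b * (c * d)) ≡ a * c * (b * d)
      lemma = solve-∀

  -- The exponents add up to n times the number of variables, so if none of them is below n
  -- then every exponent is n, which forces all k to agree.
  ∑-form^n≈diagonal : ∀ m c → ∑[ v ← vecs (allFin p) (suc m) ] form (suc m) c (residues v) ^ n ≈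
    ∑[ k ← upTo p ] (+ multinomial n (replicate (suc m) k) * c ^ (n ∸ suc m ℕ.* k) * (- 1ℤ) ^ suc m)
  ∑-form^n≈diagonal m c = begin
    ∑[ v ← vecs (allFin p) (suc m) ] form (suc m) c (residues v) ^ n
      ≡⟨ ∑-form^n {m = suc m} (suc m) c ⟩
    ∑ (vecs (upTo p) (suc m)) term
      ≡⟨ ∑-vecs (upTo p) m term ⟩
    ∑[ k ← upTo p ] ∑[ ks ← vecs (upTo p) m ] term (k ∷ ks)
      -- For a fixed leading index `k`, only the constant tail can contribute.
      ≈⟨ ∑-cong-≈ (upTo p) (λ {k} k∈ → ∑-single (vecs-unique (Unique.upTo⁺ p) m) (vecs-complete (all-replicate k∈ m))
           (offDiagonal k ∘ [ (λ ≢ → ≢ ∘ sym) , id ]′)) ⟩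
    ∑[ k ← upTo p ] term (replicate (suc m) k)
      ≈⟨ ∑-cong-≈ (upTo p) (λ {k} _ → diagonal k) ⟩
    ∑[ k ← upTo p ] (+ multinomial n (replicate (suc m) k) * c ^ (n ∸ suc m ℕ.* k) * (- 1ℤ) ^ suc m) ∎
    where
    open ≈-Reasoning
    term : Vec ℕ (suc m) → ℤ
    term ks = + multinomial n ks * c ^ (n ∸ sum ks) * ∏powerSum (exponents (suc m) ks)

    all-replicate : ∀ {k} {xs : List ℕ} → k ∈ xs → ∀ m → All (_∈ xs) (replicate m k)
    all-replicate k∈ zero    = []
    all-replicate k∈ (suc m) = k∈ ∷ all-replicate k∈ m

    term≈0 : ∀ {ks} → n < sum ks → ∀ y → + multinomial n ks * c ^ (n ∸ sum ks) * y ≈ 0ℤ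
    term≈0 {ks} n<ks y rewrite multinomial≡0 n ks n<ks = *-zeroˡ-≈ y (*-zeroˡ-≈ (c ^ (n ∸ sum ks)) (≈-refl {0ℤ}))

    exponents≥n⇒≡n : ∀ {ks : Vec ℕ (suc m)} → sum ks ≤ n → All (n ≤_) (exponents (suc m) ks) → All (_≡ n) (exponents (suc m) ks)
    exponents≥n⇒≡n {ks} ks≤n all = all-≥∧sum-minimal⇒all-≡ all (trans (sum-affine (suc m) (n ∸ sum ks) ks)
      (trans (sym (ℕ.*-distribˡ-+ (suc m) (sum ks) (n ∸ sum ks))) (cong (suc m ℕ.*_) (ℕ.m+[n∸m]≡n ks≤n))))

    offDiagonal : ∀ k {ks} → ks ≢ replicate m k → term (k ∷ ks) ≈ 0ℤ
    offDiagonal k {ks} ks≢ with n ℕ.<? sum (k ∷ ks)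
    -- Past `n` the truncated subtraction spoils the total of the exponents; the vanishing
    -- multinomial coefficient takes over.
    ... | yes n<ks = term≈0 {k ∷ ks} n<ks (∏powerSum (exponents (suc m) (k ∷ ks)))
    ... | no  n≮ks = *-zeroʳ-≈ (+ multinomial n (k ∷ ks) * c ^ (n ∸ sum (k ∷ ks))) (∏powerSum≈0 (exponents (suc m) (k ∷ ks)) ¬all)
      where
      ¬all : ¬ All (n ≤_) (exponents (suc m) (k ∷ ks))
      ¬all all with exponents≥n⇒≡n {k ∷ ks} (ℕ.≮⇒≥ n≮ks) all
      ... | px ∷ pxs = ks≢ (affine-injective m (n ∸ sum (k ∷ ks)) n k ks px pxs)

    diagonal : ∀ k → term (replicate (suc m) k) ≈ + multinomial n (replicate (suc m) k) * c ^ (n ∸ suc m ℕ.* k) * (- 1ℤ) ^ suc m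
    diagonal k with n ℕ.<? sum (replicate (suc m) k)
    ... | yes n<ks = ≈-trans (term≈0 {replicate (suc m) k} n<ks _) (≈-sym (*-zeroˡ-≈ ((- 1ℤ) ^ suc m)
      (*-zeroˡ-≈ (c ^ (n ∸ suc m ℕ.* k)) (≡⇒≈ (cong +_ (multinomial≡0 n (replicate (suc m) k) n<ks))))))
    ... | no  n≮ks = *-cong (≡⇒≈ (cong (λ s → + multinomial n (replicate (suc m) k) * c ^ (n ∸ s)) (sum-replicate (suc m) k)))
      (∏powerSum-n (subst (All (_≡ n)) (sym (Vec.map-replicate (λ k′ → suc m ℕ.* k′ ℕ.+ (n ∸ sum (replicate (suc m) k))) k (suc m)))
        (all-≡n (suc m))))
      where
      e≡n : suc m ℕ.* k ℕ.+ (n ∸ sum (replicate (suc m) k)) ≡ n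
      e≡n = trans (cong (ℕ._+ (n ∸ sum (replicate (suc m) k))) (sym (sum-replicate (suc m) k))) (ℕ.m+[n∸m]≡n (ℕ.≮⇒≥ n≮ks))
      all-≡n : ∀ m′ → All (_≡ n) (replicate m′ (suc m ℕ.* k ℕ.+ (n ∸ sum (replicate (suc m) k))))
      all-≡n zero     = []
      all-≡n (suc m′) = e≡n ∷ all-≡n m′

-- Projective points over a prime field

𝟙-yes : {P : Set ℓ} (P? : Dec P) → P → 𝟙 P? ≡ 1ℤ
𝟙-yes (yes _) _ = refl
𝟙-yes (no ¬p) p = contradiction p ¬p

𝟙-no : {P : Set ℓ} (P? : Dec P) → ¬ P → 𝟙 P? ≡ 0ℤ
𝟙-no (yes p) ¬p = contradiction p ¬p
𝟙-no (no _)  _  = refl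

allVecs≡vecs : ∀ p m → allVecs p m ≡ vecs (allFin p) m
allVecs≡vecs p zero    = refl
allVecs≡vecs p (suc m) = cong (cartesianProductWith _∷_ (allFin p)) (allVecs≡vecs p m)

module _ (DS : DecSetoid a ℓ) (p : ℕ) where

  open DecSetoid DS using (_≟_) renaming (Carrier to X; _≈_ to _∼ₓ_; refl to ∼ₓ-refl; sym to ∼ₓ-sym; trans to ∼ₓ-trans)
  open Modulo p

  -- Deduplication keeps a representative of the class of `x`, and only one, because the retained
  -- entries are pairwise inequivalent.
  ∑-representatives : ∀ (xs : List X) {x} → x ∈ xs → ∑[ r ← deduplicate _≟_ xs ] 𝟙 (r ≟ x) ≈ 1ℤ
  ∑-representatives xs {x} x∈
    with find (Any.deduplicate⁺ _≟_ (λ b∼a a∼x → ∼ₓ-trans b∼a a∼x) (lose {P = _∼ₓ x} x∈ ∼ₓ-refl))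
  ... | r , r∈ , r∼x = ≈-trans
    (∑-single {z = r} (deduplicate-! DS xs) r∈ (λ {y} r≁y → ≡⇒≈ (𝟙-no (y ≟ x)
      (λ y∼x → [ (λ ≁ → ≁ (∼ₓ-trans r∼x (∼ₓ-sym y∼x))) , (λ ≁ → ≁ (∼ₓ-trans y∼x (∼ₓ-sym r∼x))) ]′ r≁y))))
    (≡⇒≈ (𝟙-yes (r ≟ x) r∼x))

-- Vectors over the prime field and their lines

module Residues (n : ℕ) (p-prime : Prime (suc n)) where

  open PrimeField n p-prime
  open Hypersurface n p-prime

  private
    p : ℕ
    p = suc n

    𝔽 : Set
    𝔽 = Fin p

  vecs-allFin-complete : ∀ (v : Vec 𝔽 m) → v ∈ vecs (allFin p) m
  vecs-allFin-complete v = vecs-complete (All.universal ∈-allFin v)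

  -- The difference `b ∸ a` is a multiple of `p` smaller than `p`, hence zero.
  ≈⇒≤ : ∀ {a b} → b < p → a ≤ b → + b ≈ + a → b ≤ a
  ≈⇒≤ {a} {b} b<p a≤b (mk d)
    with b ∸ a in b∸a≡ | subst (p ℕ.∣_) (cong ℤ.∣_∣ (trans (ℤ.m-n≡m⊖n b a) (ℤ.⊖-≥ a≤b))) (∣⇒∣ᵤ d)
  ... | zero  | _   = ℕ.m∸n≡0⇒m≤n b∸a≡
  ... | suc k | p∣k = contradiction (ℕ.∣⇒≤ p∣k) (ℕ.<⇒≱ (ℕ.≤-<-trans (subst (_≤ b) b∸a≡ (ℕ.m∸n≤m b a)) b<p))

  res-injective : ∀ {x y} → res p x ≈ res p y → x ≡ y
  res-injective {x} {y} eq with ℕ.≤-total (toℕ x) (toℕ y)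
  ... | inj₁ x≤y = Fin.toℕ-injective (ℕ.≤-antisym x≤y (≈⇒≤ (Fin.toℕ<n y) x≤y (≈-sym eq)))
  ... | inj₂ y≤x = Fin.toℕ-injective (ℕ.≤-antisym (≈⇒≤ (Fin.toℕ<n x) y≤x eq) y≤x)

  reduce : ℤ → 𝔽
  reduce z = fromℕ< (ℤ.n%ℕd<d z p)

  res-reduce : ∀ z → res p (reduce z) ≈ z
  res-reduce z = ≈-trans (≡⇒≈ (cong +_ (Fin.toℕ-fromℕ< (ℤ.n%ℕd<d z p)))) (≈-sym (residue z))

  isZero⇐ : ∀ {x} → res p x ≈ 0ℤ → IsZero p x
  isZero⇐ eq = cong (res p) (res-injective {y = Fin.zero} eq)

  p∤res : ∀ {x} → ¬ IsZero p x → ¬ + p ∣ res p x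
  p∤res x≢0 = x≢0 ∘ isZero⇐ ∘ ∣⇒≈0

  ≢0-reduce : ∀ {z} → ¬ + p ∣ z → ¬ IsZero p (reduce z)
  ≢0-reduce {z} p∤z eq = p∤z (≈0⇒∣ (≈-trans (≈-sym (res-reduce z)) (≡⇒≈ eq)))

  -- Proportionality with an integer scalar: products and powers of scalars can be used directly,
  -- and reduction to `Fin p` is postponed to `scaled⇒∼`.
  data Scaled (c : ℤ) : Vec 𝔽 m → Vec 𝔽 m → Set where
    []  : Scaled c [] []
    _∷_ : ∀ {x y} {v w : Vec 𝔽 m} → res p y ≈ c * res p x → Scaled c v w → Scaled c (x ∷ v) (y ∷ w)

  fromPointwise : ∀ {c} {v w : Vec 𝔽 m} → Pointwise (λ x y → res p y ≡ res p c * res p x [modℤ p ]) v w → Scaled (res p c) v w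
  fromPointwise []       = []
  fromPointwise (e ∷ es) = mk e ∷ fromPointwise es

  toPointwise : ∀ {c} {v w : Vec 𝔽 m} → Scaled (res p c) v w → Pointwise (λ x y → res p y ≡ res p c * res p x [modℤ p ]) v w
  toPointwise []       = []
  toPointwise (e ∷ es) = congruent e ∷ toPointwise es

  ∼⇒scaled : ∀ {v w : Vec 𝔽 m} → _∼_ p v w → ∃[ c ] (¬ + p ∣ c) × Scaled c v w
  ∼⇒scaled (c , c≢0 , vw) = res p c , p∤res c≢0 , fromPointwise {c = c} vw

  scaled-by-1 : ∀ {c} → c ≈ 1ℤ → (v : Vec 𝔽 m) → Scaled c v v
  scaled-by-1 c≈1 []      = []
  scaled-by-1 c≈1 (x ∷ v) =
    (≈-sym (≈-trans (*-cong c≈1 ≈-refl) (≡⇒≈ (ℤ.*-identityˡ (res p x))))) ∷ scaled-by-1 c≈1 v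

  scaled-trans : ∀ {b c d} {u v w : Vec 𝔽 m} → d ≈ c * b → Scaled b u v → Scaled c v w → Scaled d u w
  scaled-trans d≈ []       []       = []
  scaled-trans {b = b} {c} {d} {x ∷ _} {y ∷ _} {z ∷ _} d≈ (e ∷ es) (f ∷ fs) = (begin
    res p z             ≈⟨ f ⟩
    c * res p y         ≈⟨ *-cong (≈-refl {c}) e ⟩
    c * (b * res p x)   ≡⟨ ℤ.*-assoc c b (res p x) ⟨
    c * b * res p x     ≈⟨ *-cong d≈ ≈-refl ⟨
    d * res p x         ∎) ∷ scaled-trans d≈ es fs
    where open ≈-Reasoning

  -- The power `c ^ (p - 2)`, inverse to `c` by Fermat.
  inverse : ℤ → ℤ
  inverse c = c ^ (n ∸ 1)

  *-inverse : ∀ {c} → ¬ + p ∣ c → c * inverse c ≈ 1ℤ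
  *-inverse {c} p∤c = ≈-trans (≡⇒≈ (cong (c ^_) (ℕ.m+[n∸m]≡n (ℕ.s≤s⁻¹ 1<p)))) (fermat p∤c)

  scaled-sym : ∀ {b c} {v w : Vec 𝔽 m} → c * b ≈ 1ℤ → Scaled c v w → Scaled b w v
  scaled-sym bc≈1 []       = []
  scaled-sym {b = b} {c} {x ∷ _} {y ∷ _} bc≈1 (e ∷ es) = (begin
    res p x             ≡⟨ ℤ.*-identityˡ (res p x) ⟨
    1ℤ * res p x        ≈⟨ *-cong bc≈1 ≈-refl ⟨
    c * b * res p x     ≡⟨ lemma c b (res p x) ⟩
    b * (c * res p x)   ≈⟨ *-cong (≈-refl {b}) e ⟨
    b * res p y         ∎) ∷ scaled-sym bc≈1 es
    where
    open ≈-Reasoning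
    lemma : ∀ c b x → c * b * x ≡ b * (c * x)
    lemma = solve-∀

  scaled⇒∼ : ∀ {c} {v w : Vec 𝔽 m} → ¬ + p ∣ c → Scaled c v w → _∼_ p v w
  -- Composing with the scaling of `v` by 1 exchanges `c` for the congruent scalar
  -- `res p (reduce c)`.
  scaled⇒∼ {c = c} {v} p∤c vw = reduce c , ≢0-reduce p∤c , toPointwise {c = reduce c} (scaled-trans
    (≈-trans (res-reduce c) (≡⇒≈ (sym (ℤ.*-identityʳ c)))) (scaled-by-1 ≈-refl v) vw)

  ∼-refl : ∀ {v : Vec 𝔽 m} → _∼_ p v v
  ∼-refl {v = v} = scaled⇒∼ p∤1 (scaled-by-1 ≈-refl v)

  ∼-sym : ∀ {v w : Vec 𝔽 m} → _∼_ p v w → _∼_ p w v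
  ∼-sym v∼w with ∼⇒scaled v∼w
  ... | c , p∤c , vw = scaled⇒∼ (p∤x^k (n ∸ 1) p∤c) (scaled-sym (*-inverse p∤c) vw)

  ∼-trans : ∀ {u v w : Vec 𝔽 m} → _∼_ p u v → _∼_ p v w → _∼_ p u w
  ∼-trans u∼v v∼w with ∼⇒scaled u∼v | ∼⇒scaled v∼w
  ... | b , p∤b , uv | c , p∤c , vw = scaled⇒∼ (p∤x*y p∤c p∤b) (scaled-trans ≈-refl uv vw)

  ∼-decSetoid : ℕ → DecSetoid 0ℓ 0ℓ
  ∼-decSetoid m = record
    { Carrier = Vec 𝔽 m
    ; _≈_ = _∼_ p
    ; isDecEquivalence = record
      { isEquivalence = record { refl = ∼-refl ; sym = ∼-sym ; trans = ∼-trans }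
      ; _≟_ = _∼?_ p
      }
    }

  scale : ℤ → Vec 𝔽 m → Vec 𝔽 m
  scale c = Vec.map (λ x → reduce (c * res p x))

  scaled-scale : ∀ c (v : Vec 𝔽 m) → Scaled c v (scale c v)
  scaled-scale c []      = []
  scaled-scale c (x ∷ v) = res-reduce (c * res p x) ∷ scaled-scale c v

  scaled⇒≡scale : ∀ {c} {v w : Vec 𝔽 m} → Scaled c v w → w ≡ scale c v
  scaled⇒≡scale []       = refl
  scaled⇒≡scale {c = c} {x ∷ _} (e ∷ es) =
    cong₂ _∷_ (res-injective (≈-trans e (≈-sym (res-reduce (c * res p x))))) (scaled⇒≡scale es)

  scaled-zero : ∀ {c} {v w : Vec 𝔽 m} → ¬ + p ∣ c → Scaled c v w → All (IsZero p) w → All (IsZero p) v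
  scaled-zero p∤c []       []       = []
  scaled-zero {c = c} p∤c (e ∷ es) (z ∷ zs) =
    isZero⇐ (*-cancelˡ-≈0 c p∤c (≈-trans (≈-sym e) (≡⇒≈ z))) ∷ scaled-zero p∤c es zs

  -- The scalar can be read off at any nonzero coordinate of `v`, which cancels.
  scaled-injective : ∀ {b c} {v w : Vec 𝔽 m} → NonZeroVec p v → Scaled b v w → Scaled c v w → b ≈ c
  scaled-injective v≢0 [] [] = contradiction [] v≢0
  scaled-injective {b = b} {c} {x ∷ v} v≢0 (e ∷ es) (f ∷ fs) with isZero? p x
  ... | yes x≡0 = scaled-injective (λ v≡0 → v≢0 (x≡0 ∷ v≡0)) es fs
  ... | no  x≢0 = *-cancelˡ-≈ (res p x) (p∤res x≢0) (≈-trans (≡⇒≈ (ℤ.*-comm (res p x) b))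
    (≈-trans (≈-trans (≈-sym e) f) (≡⇒≈ (ℤ.*-comm c (res p x)))))

  ∑ᵛ-scaled : ∀ d {t} {v w : Vec 𝔽 m} → Scaled t v w →
    ∑ᵛ (Vec.map (_^ d) (residues w)) ≈ t ^ d * ∑ᵛ (Vec.map (_^ d) (residues v))
  ∑ᵛ-scaled d {t} []       = ≡⇒≈ (sym (ℤ.*-zeroʳ (t ^ d)))
  ∑ᵛ-scaled d {t} {x ∷ v} {y ∷ w} (e ∷ es) = begin
    res p y ^ d + ∑ᵛ (Vec.map (_^ d) (residues w))   ≈⟨ +-cong (^-cong d e) (∑ᵛ-scaled d es) ⟩
    (t * res p x) ^ d + t ^ d * s                    ≡⟨ cong (λ z → z + t ^ d * s) (^-distribʳ-* d t (res p x)) ⟩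
    t ^ d * res p x ^ d + t ^ d * s                  ≡⟨ ℤ.*-distribˡ-+ (t ^ d) (res p x ^ d) s ⟨
    t ^ d * (res p x ^ d + s)                        ∎
    where
    open ≈-Reasoning
    s = ∑ᵛ (Vec.map (_^ d) (residues v))

  ∏ᵛ-scaled : ∀ {t} {v w : Vec 𝔽 m} → Scaled t v w → ∏ᵛ (residues w) ≈ t ^ m * ∏ᵛ (residues v)
  ∏ᵛ-scaled []       = ≈-refl
  ∏ᵛ-scaled {m = suc m} {t} {x ∷ v} {y ∷ w} (e ∷ es) = begin
    res p y * ∏ᵛ (residues w)                   ≈⟨ *-cong e (∏ᵛ-scaled es) ⟩
    t * res p x * (t ^ m * ∏ᵛ (residues v))     ≡⟨ lemma t (res p x) (t ^ m) (∏ᵛ (residues v)) ⟩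
    t * t ^ m * (res p x * ∏ᵛ (residues v))     ∎
    where
    open ≈-Reasoning
    lemma : ∀ t x s y → t * x * (s * y) ≡ t * s * (x * y)
    lemma = solve-∀

  -- Homogeneity: the product of all `m` coordinates has the same degree as the `m`-th powers.
  form-scaled : ∀ c {t} {v w : Vec 𝔽 m} → Scaled t v w → form m c (residues w) ≈ t ^ m * form m c (residues v)
  form-scaled {m = m} c {t} {v} {w} vw = begin
    ∑ᵛ (Vec.map (_^ m) (residues w)) + c * ∏ᵛ (residues w)   ≈⟨ +-cong (∑ᵛ-scaled m vw) (*-cong (≈-refl {c}) (∏ᵛ-scaled vw)) ⟩
    t ^ m * s + c * (t ^ m * q)                              ≡⟨ lemma (t ^ m) s c q ⟩
    t ^ m * (s + c * q)                                      ∎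
    where
    open ≈-Reasoning
    s = ∑ᵛ (Vec.map (_^ m) (residues v))
    q = ∏ᵛ (residues v)
    lemma : ∀ t s c q → t * s + c * (t * q) ≡ t * (s + c * q)
    lemma = solve-∀

  ∑-units : ∑[ c ← allFin p ] 𝟙 (¬? (isZero? p c)) ≈ - 1ℤ
  ∑-units = begin
    ∑[ c ← allFin p ] 𝟙 (¬? (isZero? p c))     ≡⟨ ∑-tabulate p id (λ c → 𝟙 (¬? (isZero? p c))) h agree ⟩
    ∑ (upTo p) h                               ≡⟨ ∑-first n h ⟩
    0ℤ + ∑[ _ ← upTo n ] 1ℤ                    ≈⟨ ∑-ones ⟩
    - 1ℤ                                       ∎
    where
    open ≈-Reasoning
    h : ℕ → ℤ
    h zero    = 0ℤ
    h (suc _) = 1ℤ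
    agree : ∀ c → 𝟙 (¬? (isZero? p c)) ≡ h (toℕ c)
    agree Fin.zero    = refl
    agree (Fin.suc _) = refl

  module _ {r : Vec 𝔽 m} (r≢0 : NonZeroVec p r) where

    scaled? : ∀ c v → Dec (Scaled (res p c) r v)
    scaled? c v = map′ (fromPointwise {c = c}) (toPointwise {c = c}) (decidable (λ x y → + p ∣? (res p y - res p c * res p x)) r v)

    -- As `r` is nonzero, at most one residue carries `r` to `v`, so counting scalars does not
    -- overcount.
    𝟙-∼ : ∀ v → 𝟙 (_∼?_ p r v) ≈ ∑[ c ← allFin p ] (𝟙 (¬? (isZero? p c)) * 𝟙 (scaled? c v))
    𝟙-∼ v with _∼?_ p r v
    ... | yes (c , c≢0 , rv′) = ≈-sym (≈-trans
      (∑-single {z = c} (Unique.allFin⁺ p) (∈-allFin c) (off ∘ [ (λ ≢ → ≢ ∘ sym) , id ]′))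
      (≡⇒≈ (cong₂ _*_ (𝟙-yes (¬? (isZero? p c)) c≢0) (𝟙-yes (scaled? c v) rv))))
      where
      rv = fromPointwise {c = c} rv′
      off : ∀ {b} → b ≢ c → 𝟙 (¬? (isZero? p b)) * 𝟙 (scaled? b v) ≈ 0ℤ
      off {b} b≢c = *-zeroʳ-≈ (𝟙 (¬? (isZero? p b))) (≡⇒≈ (𝟙-no (scaled? b v) (λ rv′ → b≢c (res-injective (scaled-injective r≢0 rv′ rv)))))
    ... | no ¬r∼v = ≈-sym (∑-zero-≈ (allFin p) (λ {c} _ → vanish c))
      where
      vanish : ∀ c → 𝟙 (¬? (isZero? p c)) * 𝟙 (scaled? c v) ≈ 0ℤ
      vanish c with ¬? (isZero? p c)
      ... | yes c≢0 = *-zeroʳ-≈ 1ℤ (≡⇒≈ (𝟙-no (scaled? c v) (λ rv → ¬r∼v (c , c≢0 , toPointwise {c = c} rv))))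
      ... | no  _   = ≡⇒≈ (ℤ.*-zeroˡ (𝟙 (scaled? c v)))

    -- Double counting: after the swap of sums each unit scalar yields exactly one vector, so the
    -- class of `r` has p - 1 elements.
    ∑-∼ : ∑[ v ← vecs (allFin p) m ] 𝟙 (_∼?_ p r v) ≈ - 1ℤ
    ∑-∼ = begin
      ∑[ v ← vecs (allFin p) m ] 𝟙 (_∼?_ p r v)
        ≈⟨ ∑-cong-≈ (vecs (allFin p) m) (λ {v} _ → 𝟙-∼ v) ⟩
      ∑[ v ← vecs (allFin p) m ] ∑[ c ← allFin p ] (𝟙 (¬? (isZero? p c)) * 𝟙 (scaled? c v))
        ≡⟨ ∑-swap (vecs (allFin p) m) (allFin p) (λ v c → 𝟙 (¬? (isZero? p c)) * 𝟙 (scaled? c v)) ⟩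
      ∑[ c ← allFin p ] ∑[ v ← vecs (allFin p) m ] (𝟙 (¬? (isZero? p c)) * 𝟙 (scaled? c v))
        ≈⟨ ∑-cong-≈ (allFin p) (λ {c} _ → one c) ⟩
      ∑[ c ← allFin p ] 𝟙 (¬? (isZero? p c))
        ≈⟨ ∑-units ⟩
      - 1ℤ ∎
      where
      open ≈-Reasoning
      one : ∀ c → ∑[ v ← vecs (allFin p) m ] (𝟙 (¬? (isZero? p c)) * 𝟙 (scaled? c v)) ≈ 𝟙 (¬? (isZero? p c))
      one c = begin
        ∑[ v ← vecs (allFin p) m ] (𝟙 (¬? (isZero? p c)) * 𝟙 (scaled? c v))
          ≡⟨ ∑-*ˡ (vecs (allFin p) m) (𝟙 (¬? (isZero? p c))) (𝟙 ∘ scaled? c) ⟩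
        𝟙 (¬? (isZero? p c)) * (∑[ v ← vecs (allFin p) m ] 𝟙 (scaled? c v))
          ≈⟨ *-cong (≈-refl {𝟙 (¬? (isZero? p c))}) (∑-single {z = scale (res p c) r} (vecs-unique (Unique.allFin⁺ p) m)
               (vecs-allFin-complete _) (off ∘ [ (λ ≢ → ≢ ∘ sym) , id ]′)) ⟩
        𝟙 (¬? (isZero? p c)) * 𝟙 (scaled? c (scale (res p c) r))
          ≡⟨ cong (𝟙 (¬? (isZero? p c)) *_) (𝟙-yes (scaled? c _) (scaled-scale (res p c) r)) ⟩
        𝟙 (¬? (isZero? p c)) * 1ℤ
          ≡⟨ ℤ.*-identityʳ _ ⟩
        𝟙 (¬? (isZero? p c)) ∎
        where
        off : ∀ {v} → v ≢ scale (res p c) r → 𝟙 (scaled? c v) ≈ 0ℤ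
        off {v} v≢ = ≡⇒≈ (𝟙-no (scaled? c v) (v≢ ∘ scaled⇒≡scale))

-- The Dwork surface

module Dwork (n : ℕ) (p-prime : Prime (suc n)) (λ′ : ℤ) where

  open PrimeField n p-prime
  open Hypersurface n p-prime
  open Residues n p-prime

  private
    p : ℕ
    p = suc n

    𝔽⁴ : List (Vec (Fin p) 4)
    𝔽⁴ = vecs (allFin p) 4

    F : Vec (Fin p) 4 → ℤ
    F v = form 4 (- (+ 4 * λ′)) (residues v)

    _∼ₚ?_ : (v w : Vec (Fin p) 4) → Dec (_∼_ p v w)
    _∼ₚ?_ = _∼?_ p

  -- The right side is `form` unfolded on four coordinates; its trailing `0ℤ` and `1ℤ` are the
  -- values of `∑ᵛ` and `∏ᵛ` on the empty vector.
  F≡ : ∀ a b c d x y z w l → a + b + c + d - + 4 * l * x * y * z * w ≡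
    (a + (b + (c + (d + 0ℤ)))) + (- (+ 4 * l)) * (x * (y * (z * (w * 1ℤ))))
  F≡ = solve-∀

  onDwork⇒F≈0 : ∀ v → OnDwork p λ′ v → F v ≈ 0ℤ
  onDwork⇒F≈0 (x ∷ y ∷ z ∷ w ∷ []) p∣F = ∣⇒≈0 (subst (+ p ∣_)
    (F≡ (res p x ^ 4) (res p y ^ 4) (res p z ^ 4) (res p w ^ 4) (res p x) (res p y) (res p z) (res p w) λ′) p∣F)

  F≈0⇒onDwork : ∀ v → F v ≈ 0ℤ → OnDwork p λ′ v
  F≈0⇒onDwork (x ∷ y ∷ z ∷ w ∷ []) F≈0 = subst (+ p ∣_)
    (sym (F≡ (res p x ^ 4) (res p y ^ 4) (res p z ^ 4) (res p w ^ 4) (res p x) (res p y) (res p z) (res p w) λ′)) (≈0⇒∣ F≈0)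

  solutions : List (Vec (Fin p) 4)
  solutions = filter (onDwork? p λ′) (filter (nonZeroVec? p) (allVecs p 4))

  ∑-solutions : ∀ f → ∑ solutions f ≡ ∑[ v ← 𝔽⁴ ] (𝟙 (nonZeroVec? p v) * (𝟙 (onDwork? p λ′ v) * f v))
  ∑-solutions f = trans (∑-filter (onDwork? p λ′) (filter (nonZeroVec? p) (allVecs p 4)) f)
    (trans (∑-filter (nonZeroVec? p) (allVecs p 4) (λ v → 𝟙 (onDwork? p λ′ v) * f v))
      (cong (λ vs → ∑[ v ← vs ] (𝟙 (nonZeroVec? p v) * (𝟙 (onDwork? p λ′ v) * f v))) (allVecs≡vecs p 4)))

  solutions⁻ : ∀ {v} → v ∈ solutions → NonZeroVec p v × OnDwork p λ′ v
  solutions⁻ v∈ with ∈-filter⁻ (onDwork? p λ′) {xs = filter (nonZeroVec? p) (allVecs p 4)} v∈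
  ... | v∈′ , Fv = proj₂ (∈-filter⁻ (nonZeroVec? p) {xs = allVecs p 4} v∈′) , Fv

  -- By homogeneity the whole class of a solution consists of nonzero solutions, so restricting the
  -- sum to `solutions` loses nothing.
  ∑-class : ∀ {r} → r ∈ solutions → ∑[ v ← solutions ] 𝟙 (r ∼ₚ? v) ≈ - 1ℤ
  ∑-class {r} r∈ = begin
    ∑[ v ← solutions ] 𝟙 (r ∼ₚ? v)
      ≡⟨ ∑-solutions (λ v → 𝟙 (r ∼ₚ? v)) ⟩
    ∑[ v ← 𝔽⁴ ] (𝟙 (nonZeroVec? p v) * (𝟙 (onDwork? p λ′ v) * 𝟙 (r ∼ₚ? v)))
      ≡⟨ ∑-cong 𝔽⁴ (λ {v} _ → class⊆solutions v (r ∼ₚ? v)) ⟩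
    ∑[ v ← 𝔽⁴ ] 𝟙 (r ∼ₚ? v)
      ≈⟨ ∑-∼ r≢0 ⟩
    - 1ℤ ∎
    where
    open ≈-Reasoning
    r≢0 = proj₁ (solutions⁻ r∈)
    class⊆solutions : ∀ v (r∼v? : Dec (_∼_ p r v)) → 𝟙 (nonZeroVec? p v) * (𝟙 (onDwork? p λ′ v) * 𝟙 r∼v?) ≡ 𝟙 r∼v?
    class⊆solutions v (no _)    = trans (cong (𝟙 (nonZeroVec? p v) *_) (ℤ.*-zeroʳ (𝟙 (onDwork? p λ′ v)))) (ℤ.*-zeroʳ (𝟙 (nonZeroVec? p v)))
    class⊆solutions v (yes r∼v) with ∼⇒scaled r∼v
    ... | c , p∤c , rv = cong₂ (λ x y → x * (y * 1ℤ))
      (𝟙-yes (nonZeroVec? p v) (r≢0 ∘ scaled-zero p∤c rv))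
      (𝟙-yes (onDwork? p λ′ v) (F≈0⇒onDwork v (≈-trans (form-scaled (- (+ 4 * λ′)) rv)
        (*-zeroʳ-≈ (c ^ 4) (onDwork⇒F≈0 r (proj₂ (solutions⁻ r∈)))))))

  -- Pairs of a representative and an equivalent solution are counted twice: by `∑-class` for each
  -- representative, by `∑-representatives` for each solution.
  #Dwork≈ : + #Dwork p λ′ ≈ - (∑[ _ ← solutions ] 1ℤ)
  #Dwork≈ = begin
    + #Dwork p λ′
      ≡⟨ lemma (+ #Dwork p λ′) ⟩
    - (+ #Dwork p λ′ * - 1ℤ)
      ≡⟨ cong -_ (∑-const (DworkPoints p λ′) (- 1ℤ)) ⟨
    - (∑[ _ ← DworkPoints p λ′ ] (- 1ℤ))
      ≈⟨ neg-cong (∑-cong-≈ (DworkPoints p λ′) (λ r∈ → ∑-class (∈-deduplicate⁻ (_∼?_ p) solutions r∈))) ⟨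
    - (∑[ r ← DworkPoints p λ′ ] ∑[ v ← solutions ] 𝟙 (r ∼ₚ? v))
      ≡⟨ cong -_ (∑-swap (DworkPoints p λ′) solutions (λ r v → 𝟙 (r ∼ₚ? v))) ⟩
    - (∑[ v ← solutions ] ∑[ r ← DworkPoints p λ′ ] 𝟙 (r ∼ₚ? v))
      ≈⟨ neg-cong (∑-cong-≈ solutions (∑-representatives (∼-decSetoid 4) p solutions)) ⟩
    - (∑[ _ ← solutions ] 1ℤ) ∎
    where
    open ≈-Reasoning
    lemma : ∀ x → x ≡ - (x * - 1ℤ)
    lemma = solve-∀

  𝟙-onDwork : ∀ v → 𝟙 (onDwork? p λ′ v) ≈ 1ℤ - F v ^ n
  𝟙-onDwork v with onDwork? p λ′ v
  ... | yes Fv≈0 = ≈-sym (+-cong (≈-refl {1ℤ}) (neg-cong (≈-trans (^-cong n (onDwork⇒F≈0 v Fv≈0)) (≡⇒≈ 0^n≡0))))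
  ... | no  Fv≉0 = ≈-sym (+-cong (≈-refl {1ℤ}) (neg-cong (fermat (Fv≉0 ∘ F≈0⇒onDwork v ∘ ∣⇒≈0))))

  ∑-onDwork : ∑[ v ← 𝔽⁴ ] 𝟙 (onDwork? p λ′ v) ≈ - (∑[ v ← 𝔽⁴ ] F v ^ n)
  ∑-onDwork = begin
    ∑[ v ← 𝔽⁴ ] 𝟙 (onDwork? p λ′ v)
      ≈⟨ ∑-cong-≈ 𝔽⁴ (λ {v} _ → 𝟙-onDwork v) ⟩
    ∑[ v ← 𝔽⁴ ] (1ℤ - F v ^ n)
      ≡⟨ ∑-cong 𝔽⁴ (λ {v} _ → cong (λ s → 1ℤ + s) (sym (ℤ.-1*i≡-i (F v ^ n)))) ⟩
    ∑[ v ← 𝔽⁴ ] (1ℤ + - 1ℤ * F v ^ n)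
      ≡⟨ ∑-+ 𝔽⁴ (λ _ → 1ℤ) (λ v → - 1ℤ * F v ^ n) ⟩
    (∑[ _ ← 𝔽⁴ ] 1ℤ) + (∑[ v ← 𝔽⁴ ] (- 1ℤ * F v ^ n))
      -- One of the four factors `p` in the number of vectors suffices to make that number vanish
      -- modulo `p`.
      ≡⟨ cong₂ _+_ (trans (∑-vecs (allFin p) 3 (λ _ → 1ℤ)) (∑-const (allFin p) (∑[ _ ← vecs (allFin p) 3 ] 1ℤ)))
           (trans (∑-*ˡ 𝔽⁴ (- 1ℤ) (λ v → F v ^ n)) (ℤ.-1*i≡-i (∑[ v ← 𝔽⁴ ] F v ^ n))) ⟩
    + length (allFin p) * (∑[ _ ← vecs (allFin p) 3 ] 1ℤ) + - (∑[ v ← 𝔽⁴ ] F v ^ n)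
      ≈⟨ +-cong (*-zeroˡ-≈ (∑[ _ ← vecs (allFin p) 3 ] 1ℤ) (≈-trans (≡⇒≈ (cong +_ (List.length-tabulate id))) p≈0))
           (≈-refl { - (∑[ v ← 𝔽⁴ ] F v ^ n)}) ⟩
    0ℤ + - (∑[ v ← 𝔽⁴ ] F v ^ n)
      ≡⟨ ℤ.+-identityˡ _ ⟩
    - (∑[ v ← 𝔽⁴ ] F v ^ n) ∎
    where open ≈-Reasoning

  allZero⇒≡0 : ∀ {m} {v : Vec (Fin p) m} → All (IsZero p) v → v ≡ replicate m Fin.zero
  allZero⇒≡0 []       = refl
  allZero⇒≡0 (z ∷ zs) = cong₂ _∷_ (res-injective {y = Fin.zero} (≡⇒≈ z)) (allZero⇒≡0 zs)

  ∑-allZero : ∑[ v ← 𝔽⁴ ] 𝟙 (All.all? (isZero? p) v) ≈ 1ℤ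
  ∑-allZero = ∑-single {z = replicate 4 Fin.zero} (vecs-unique (Unique.allFin⁺ p) 4) (vecs-allFin-complete _)
    (λ {v} 0≢v → ≡⇒≈ (𝟙-no (All.all? (isZero? p) v) (λ v≡0 → [ (λ ≢ → ≢ (sym (allZero⇒≡0 v≡0))) , (λ ≢ → ≢ (allZero⇒≡0 v≡0)) ]′ 0≢v)))

  ∑-solutions-1 : ∑[ _ ← solutions ] 1ℤ ≈ - (∑[ v ← 𝔽⁴ ] F v ^ n) - 1ℤ
  ∑-solutions-1 = begin
    ∑[ _ ← solutions ] 1ℤ
      ≡⟨ ∑-solutions (λ _ → 1ℤ) ⟩
    ∑[ v ← 𝔽⁴ ] (𝟙 (nonZeroVec? p v) * (𝟙 (onDwork? p λ′ v) * 1ℤ))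
      ≡⟨ ∑-cong 𝔽⁴ (λ {v} _ → split v (All.all? (isZero? p) v)) ⟩
    ∑[ v ← 𝔽⁴ ] (𝟙 (onDwork? p λ′ v) + - 1ℤ * 𝟙 (All.all? (isZero? p) v))
      ≡⟨ ∑-+ 𝔽⁴ (λ v → 𝟙 (onDwork? p λ′ v)) (λ v → - 1ℤ * 𝟙 (All.all? (isZero? p) v)) ⟩
    (∑[ v ← 𝔽⁴ ] 𝟙 (onDwork? p λ′ v)) + (∑[ v ← 𝔽⁴ ] (- 1ℤ * 𝟙 (All.all? (isZero? p) v)))
      ≡⟨ cong (λ s → (∑[ v ← 𝔽⁴ ] 𝟙 (onDwork? p λ′ v)) + s) (∑-*ˡ 𝔽⁴ (- 1ℤ) (λ v → 𝟙 (All.all? (isZero? p) v))) ⟩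
    (∑[ v ← 𝔽⁴ ] 𝟙 (onDwork? p λ′ v)) + - 1ℤ * (∑[ v ← 𝔽⁴ ] 𝟙 (All.all? (isZero? p) v))
      ≈⟨ +-cong ∑-onDwork (*-cong (≈-refl { - 1ℤ}) ∑-allZero) ⟩
    - (∑[ v ← 𝔽⁴ ] F v ^ n) - 1ℤ ∎
    where
    open ≈-Reasoning
    F[0]≈0 : ∀ {v} → All (IsZero p) v → OnDwork p λ′ v
    F[0]≈0 v≡0 rewrite allZero⇒≡0 v≡0 = congruent {0ℤ} (≡⇒≈ (sym (ℤ.*-zeroʳ (+ 4 * λ′ * 0ℤ * 0ℤ * 0ℤ))))
    -- The zero vector satisfies the equation, so discarding it subtracts its indicator.
    split : ∀ v (v≡0? : Dec (All (IsZero p) v)) →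
      𝟙 (¬? v≡0?) * (𝟙 (onDwork? p λ′ v) * 1ℤ) ≡ 𝟙 (onDwork? p λ′ v) + - 1ℤ * 𝟙 v≡0?
    split v (yes v≡0) = trans (ℤ.*-zeroˡ (𝟙 (onDwork? p λ′ v) * 1ℤ)) (cong (λ s → s + - 1ℤ * 1ℤ) (sym (𝟙-yes (onDwork? p λ′ v) (F[0]≈0 v≡0))))
    split v (no _)    = lemma (𝟙 (onDwork? p λ′ v))
      where
      lemma : ∀ x → 1ℤ * (x * 1ℤ) ≡ x + - 1ℤ * 0ℤ
      lemma = solve-∀

  frobeniusTrace≈ : frobeniusTrace p λ′ ≈ ∑[ v ← 𝔽⁴ ] F v ^ n
  frobeniusTrace≈ = begin
    + #Dwork p λ′ - + (p ℕ.^ 2) - 1ℤ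
      ≈⟨ +-cong (+-cong (≈-trans #Dwork≈ (neg-cong ∑-solutions-1)) (neg-cong p²≈0)) (≈-refl { - 1ℤ}) ⟩
    -- The discarded zero vector accounts for the inner `1ℤ`, which cancels the one in the
    -- definition of the trace.
    - (- (∑[ v ← 𝔽⁴ ] F v ^ n) - 1ℤ) - 0ℤ - 1ℤ
      ≡⟨ lemma (∑[ v ← 𝔽⁴ ] F v ^ n) ⟩
    ∑[ v ← 𝔽⁴ ] F v ^ n ∎
    where
    open ≈-Reasoning
    p²≈0 : + (p ℕ.^ 2) ≈ 0ℤ
    p²≈0 = ≈-trans (≡⇒≈ (ℤ.pos-* p (p ℕ.^ 1))) (*-zeroˡ-≈ (+ (p ℕ.^ 1)) p≈0)
    lemma : ∀ s → - (- s - 1ℤ) - 0ℤ - 1ℤ ≡ s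
    lemma = solve-∀

-- The diagonal coefficients

module Coefficient (n : ℕ) (p-prime : Prime (suc n)) where

  open PrimeField n p-prime

  private
    p : ℕ
    p = suc n

  p∣k! : ∀ {k} → n < k → + (k !) ≈ 0ℤ
  p∣k! n<k = ∣⇒≈0 (∣ᵤ⇒∣ (ℕ.∣-trans (ℕ.m∣m*n (n !)) (ℕ.m≤n⇒m!∣n! n<k)))

  -- With s = `sum ks`, the left side is n!/(n-s)!, a product of s factors congruent to -1, ..., -s.
  -- For s > n both sides vanish, since then `p` divides s!.
  multinomial≈ : ∀ {m} (ks : Vec ℕ m) → + multinomial n ks * + ∏! ks ≈ (- 1ℤ) ^ sum ks * + (sum ks !)
  multinomial≈ ks with n ℕ.<? sum ks
  ... | yes n<ks = ≈-trans (*-zeroˡ-≈ (+ ∏! ks) (≡⇒≈ (cong +_ (multinomial≡0 n ks n<ks)))) (≈-sym (*-zeroʳ-≈ ((- 1ℤ) ^ sum ks) (p∣k! n<ks)))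
  ... | no  n≮ks = *-cancelˡ-≈ (+ (j !)) (p∤k! (s≤s (ℕ.m∸n≤m n (sum ks)))) (begin
    + (j !) * (+ multinomial n ks * + ∏! ks)            ≡⟨ ℤ.*-comm (+ (j !)) _ ⟩
    + multinomial n ks * + ∏! ks * + (j !)              ≡⟨ cong (_* + (j !)) (ℤ.pos-* (multinomial n ks) (∏! ks)) ⟨
    + (multinomial n ks ℕ.* ∏! ks) * + (j !)            ≡⟨ ℤ.pos-* (multinomial n ks ℕ.* ∏! ks) (j !) ⟨
    + (multinomial n ks ℕ.* ∏! ks ℕ.* j !)              ≡⟨ cong +_ (multinomial-! n ks (ℕ.≮⇒≥ n≮ks)) ⟩
    + (n !)                                             ≈⟨ n!≈ (sum ks) (ℕ.≮⇒≥ n≮ks) ⟩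
    (- 1ℤ) ^ sum ks * + (sum ks !) * + (j !)            ≡⟨ ℤ.*-comm _ (+ (j !)) ⟩
    + (j !) * ((- 1ℤ) ^ sum ks * + (sum ks !))          ∎)
    where
    open ≈-Reasoning
    j = n ∸ sum ks

  module _ {c : ℤ} (p∤c : ¬ + p ∣ c) where

    -- `coefficient k` is the k-th diagonal term, with one sign from each of the four power sums.
    -- `denominator k` is k!⁴ c⁴ᵏ, which will also clear the k-th period term.
    coefficient denominator : ℕ → ℤ
    coefficient k = + multinomial n (replicate 4 k) * c ^ (n ∸ 4 ℕ.* k) * (- 1ℤ) ^ 4
    denominator k = + ∏! (replicate 4 k) * c ^ (4 ℕ.* k)

    p∤denominator : ∀ {k} → k < p → ¬ + p ∣ denominator k
    p∤denominator {k} k<p = p∤x*y (subst (λ z → ¬ + p ∣ z) (sym ∏!≡) (p∤x^k 4 (p∤k! k<p))) (p∤x^k (4 ℕ.* k) p∤c)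
      where
      ∏!≡ : + ∏! (replicate 4 k) ≡ (+ (k !)) ^ 4
      ∏!≡ = trans (ℤ.pos-* (k !) _) (cong (+ (k !) *_) (trans (ℤ.pos-* (k !) _) (cong (+ (k !) *_)
        (trans (ℤ.pos-* (k !) _) (cong (+ (k !) *_) (ℤ.pos-* (k !) 1))))))

    -- The powers of `c` combine to `c ^ n`, which is 1 by Fermat, and the sign has the even
    -- exponent 4k. For 4k > n both sides are 0 modulo `p`.
    denominator*coefficient : ∀ k → denominator k * coefficient k ≈ + ((4 ℕ.* k) !)
    denominator*coefficient k with n ℕ.<? 4 ℕ.* k
    ... | yes n<4k = ≈-trans (*-zeroʳ-≈ (denominator k) (*-zeroˡ-≈ ((- 1ℤ) ^ 4) (*-zeroˡ-≈ (c ^ (n ∸ 4 ℕ.* k))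
      (≡⇒≈ (cong +_ (multinomial≡0 n (replicate 4 k) n<4k)))))) (≈-sym (p∣k! n<4k))
    ... | no  n≮4k = begin
      + ∏! (replicate 4 k) * c ^ (4 ℕ.* k) * (+ multinomial n (replicate 4 k) * c ^ (n ∸ 4 ℕ.* k) * (- 1ℤ) ^ 4)
        ≡⟨ regroup (+ ∏! (replicate 4 k)) (c ^ (4 ℕ.* k)) (+ multinomial n (replicate 4 k)) (c ^ (n ∸ 4 ℕ.* k)) ⟩
      + multinomial n (replicate 4 k) * + ∏! (replicate 4 k) * (c ^ (4 ℕ.* k) * c ^ (n ∸ 4 ℕ.* k))
        ≡⟨ cong (+ multinomial n (replicate 4 k) * + ∏! (replicate 4 k) *_) (trans (sym (ℤ.^-distribˡ-+-* c (4 ℕ.* k) (n ∸ 4 ℕ.* k)))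
             (cong (c ^_) (ℕ.m+[n∸m]≡n (ℕ.≮⇒≥ n≮4k)))) ⟩
      + multinomial n (replicate 4 k) * + ∏! (replicate 4 k) * c ^ n
        ≈⟨ *-cong (multinomial≈ (replicate 4 k)) (fermat p∤c) ⟩
      (- 1ℤ) ^ (4 ℕ.* k) * + ((4 ℕ.* k) !) * 1ℤ
        ≡⟨ cong (λ s → s * + ((4 ℕ.* k) !) * 1ℤ) (trans (sym (ℤ.^-*-assoc (- 1ℤ) 4 k)) (ℤ.^-zeroˡ k)) ⟩
      1ℤ * + ((4 ℕ.* k) !) * 1ℤ
        ≡⟨ trans (ℤ.*-identityʳ _) (ℤ.*-identityˡ _) ⟩
      + ((4 ℕ.* k) !) ∎
      where
      open ≈-Reasoning
      regroup : ∀ a b c d → a * b * (c * d * 1ℤ) ≡ c * a * (b * d)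
      regroup = solve-∀

-- Integers in ℚ and the Pochhammer numerators

toℚᵘ-fromℤ : ∀ z → toℚᵘ (fromℤ z) ≃ᵘ mkℚᵘ z 0
toℚᵘ-fromℤ z = ℚ.toℚᵘ-fromℚᵘ (mkℚᵘ z 0)

-- Since `_/_` normalises by a gcd, the identity is checked on unnormalised rationals, where it is a
-- cross-multiplied integer equation.
fromℤ-+ : ∀ x y → fromℤ (x + y) ≡ fromℤ x ℚ.+ fromℤ y
fromℤ-+ x y = ℚ.toℚᵘ-injective (begin
  toℚᵘ (fromℤ (x + y))              ≈⟨ toℚᵘ-fromℤ (x + y) ⟩
  mkℚᵘ (x + y) 0                    ≈⟨ *≡* (lemma x y) ⟩
  mkℚᵘ x 0 +ᵘ mkℚᵘ y 0              ≈⟨ ℚᵘ.+-cong (toℚᵘ-fromℤ x) (toℚᵘ-fromℤ y) ⟨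
  toℚᵘ (fromℤ x) +ᵘ toℚᵘ (fromℤ y)  ≈⟨ ℚ.toℚᵘ-homo-+ (fromℤ x) (fromℤ y) ⟨
  toℚᵘ (fromℤ x ℚ.+ fromℤ y)        ∎)
  where
  open ℚᵘ.≃-Reasoning
  lemma : ∀ x y → (x + y) * 1ℤ ≡ (x * 1ℤ + y * 1ℤ) * 1ℤ
  lemma = solve-∀

fromℤ-* : ∀ x y → fromℤ (x * y) ≡ fromℤ x ℚ.* fromℤ y
fromℤ-* x y = ℚ.toℚᵘ-injective (begin
  toℚᵘ (fromℤ (x * y))              ≈⟨ toℚᵘ-fromℤ (x * y) ⟩
  mkℚᵘ x 0 *ᵘ mkℚᵘ y 0              ≈⟨ ℚᵘ.*-cong (toℚᵘ-fromℤ x) (toℚᵘ-fromℤ y) ⟨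
  toℚᵘ (fromℤ x) *ᵘ toℚᵘ (fromℤ y)  ≈⟨ ℚ.toℚᵘ-homo-* (fromℤ x) (fromℤ y) ⟨
  toℚᵘ (fromℤ x ℚ.* fromℤ y)        ∎)
  where open ℚᵘ.≃-Reasoning

fromℤ-^ : ∀ x k → fromℤ (x ^ k) ≡ fromℤ x Defs.^ k
fromℤ-^ x zero    = refl
fromℤ-^ x (suc k) = trans (fromℤ-* x (x ^ k)) (cong (fromℤ x ℚ.*_) (fromℤ-^ x k))

fromℤ-pos-* : ∀ x y → fromℤ (+ (x ℕ.* y)) ≡ fromℤ (+ x) ℚ.* fromℤ (+ y)
fromℤ-pos-* x y = trans (cong fromℤ (ℤ.pos-* x y)) (fromℤ-* (+ x) (+ y))

^-distribʳ-*-ℚ : ∀ x y k → (x ℚ.* y) Defs.^ k ≡ x Defs.^ k ℚ.* y Defs.^ k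
^-distribʳ-*-ℚ = Exp.^-distrib-* (CommutativeRing.commutativeSemiring ℚ.+-*-commutativeRing)

^-zeroˡ-ℚ : ∀ k → 1ℚ Defs.^ k ≡ 1ℚ
^-zeroˡ-ℚ zero    = refl
^-zeroˡ-ℚ (suc k) = trans (ℚ.*-identityˡ _) (^-zeroˡ-ℚ k)

numerator : ℕ → ℚ
numerator j = pochhammer (+ 1 / 4) j ℚ.* pochhammer (+ 2 / 4) j ℚ.* pochhammer (+ 3 / 4) j

-- Reading `j !` as the fourth symbol (4/4)ⱼ, each step adds the factors i/4 + j for i = 1, ..., 4,
-- and four factors -4 turn them into 4j + i, the signs cancelling. The base is -4 rather than 4 to
-- match c = -4λ.
numerator≡ : ∀ j → numerator j ℚ.* (fromℤ (+ (j !)) ℚ.* fromℤ (- + 4) Defs.^ (4 ℕ.* j)) ≡ fromℤ (+ ((4 ℕ.* j) !))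
numerator≡ zero    = refl
numerator≡ (suc j) = begin
  numerator (suc j) ℚ.* (fromℤ (+ (suc j !)) ℚ.* fromℤ (- + 4) Defs.^ (4 ℕ.* suc j))
    ≡⟨ cong₂ (λ a b → numerator (suc j) ℚ.* (a ℚ.* b))
         (trans (fromℤ-pos-* (suc j) (j !)) (cong (ℚ._* J) (fromℤ-+ 1ℤ (+ j))))
         (cong (fromℤ (- + 4) Defs.^_) (ℕ.*-suc 4 j)) ⟩
  numerator (suc j) ℚ.* ((1ℚ ℚ.+ x) ℚ.* J ℚ.* (q ℚ.* (q ℚ.* (q ℚ.* (q ℚ.* w)))))
    ≡⟨ step (pochhammer (+ 1 / 4) j) (pochhammer (+ 2 / 4) j) (pochhammer (+ 3 / 4) j) x J w ⟩
  affine 4 ℚ.* (affine 3 ℚ.* (affine 2 ℚ.* (affine 1 ℚ.* (numerator j ℚ.* (J ℚ.* w)))))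
    ≡⟨ cong (λ z → affine 4 ℚ.* (affine 3 ℚ.* (affine 2 ℚ.* (affine 1 ℚ.* z)))) (numerator≡ j) ⟩
  affine 4 ℚ.* (affine 3 ℚ.* (affine 2 ℚ.* (affine 1 ℚ.* fromℤ (+ ((4 ℕ.* j) !)))))
    ≡⟨ cong (λ z → affine 4 ℚ.* (affine 3 ℚ.* (affine 2 ℚ.* z))) (factor 1 ((4 ℕ.* j) !)) ⟩
  affine 4 ℚ.* (affine 3 ℚ.* (affine 2 ℚ.* fromℤ (+ ((1 ℕ.+ 4 ℕ.* j) !))))
    ≡⟨ cong (λ z → affine 4 ℚ.* (affine 3 ℚ.* z)) (factor 2 ((1 ℕ.+ 4 ℕ.* j) !)) ⟩
  affine 4 ℚ.* (affine 3 ℚ.* fromℤ (+ ((2 ℕ.+ 4 ℕ.* j) !)))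
    ≡⟨ cong (affine 4 ℚ.*_) (factor 3 ((2 ℕ.+ 4 ℕ.* j) !)) ⟩
  affine 4 ℚ.* fromℤ (+ ((3 ℕ.+ 4 ℕ.* j) !))
    ≡⟨ factor 4 ((3 ℕ.+ 4 ℕ.* j) !) ⟩
  fromℤ (+ ((4 ℕ.+ 4 ℕ.* j) !))
    ≡⟨ cong (λ m → fromℤ (+ (m !))) (sym (ℕ.*-suc 4 j)) ⟩
  fromℤ (+ ((4 ℕ.* suc j) !)) ∎
  where
  open ≡-Reasoning
  x = fromℤ (+ j)
  J = fromℤ (+ (j !))
  q = fromℤ (- + 4)
  w = q Defs.^ (4 ℕ.* j)
  affine : ℕ → ℚ
  affine i = fromℤ (+ i) ℚ.+ fromℤ (+ 4) ℚ.* x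
  factor : ∀ i f → affine i ℚ.* fromℤ (+ f) ≡ fromℤ (+ ((i ℕ.+ 4 ℕ.* j) ℕ.* f))
  factor i f = sym (trans (fromℤ-pos-* (i ℕ.+ 4 ℕ.* j) f) (cong (ℚ._* fromℤ (+ f))
    (trans (fromℤ-+ (+ i) (+ (4 ℕ.* j))) (cong (fromℤ (+ i) ℚ.+_) (fromℤ-pos-* 4 j)))))
  step : ∀ a b c x J w →
    a ℚ.* (+ 1 / 4 ℚ.+ x) ℚ.* (b ℚ.* (+ 2 / 4 ℚ.+ x)) ℚ.* (c ℚ.* (+ 3 / 4 ℚ.+ x)) ℚ.*
      ((1ℚ ℚ.+ x) ℚ.* J ℚ.* (q ℚ.* (q ℚ.* (q ℚ.* (q ℚ.* w))))) ≡
    (fromℤ (+ 4) ℚ.+ fromℤ (+ 4) ℚ.* x) ℚ.* ((fromℤ (+ 3) ℚ.+ fromℤ (+ 4) ℚ.* x) ℚ.* ((fromℤ (+ 2) ℚ.+ fromℤ (+ 4) ℚ.* x) ℚ.*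
      ((fromℤ (+ 1) ℚ.+ fromℤ (+ 4) ℚ.* x) ℚ.* (a ℚ.* b ℚ.* c ℚ.* (J ℚ.* w)))))
  step = solve 6 (λ a b c x J w →
    a :* (con (+ 1 / 4) :+ x) :* (b :* (con (+ 2 / 4) :+ x)) :* (c :* (con (+ 3 / 4) :+ x)) :*
      ((con 1ℚ :+ x) :* J :* (con q :* (con q :* (con q :* (con q :* w))))) :=
    (con (fromℤ (+ 4)) :+ con (fromℤ (+ 4)) :* x) :* ((con (fromℤ (+ 3)) :+ con (fromℤ (+ 4)) :* x) :*
      ((con (fromℤ (+ 2)) :+ con (fromℤ (+ 4)) :* x) :*
      ((con (fromℤ (+ 1)) :+ con (fromℤ (+ 4)) :* x) :* (a :* b :* c :* (J :* w)))))) refl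
    where open +-*-Solver

-- Congruences in the localisation

-- The exact rational counterpart of `denominator*coefficient`, with the same denominator and the
-- same numerator (4k)!.
denominator*periodTerm : ∀ λ′ .{{_ : ℤ.NonZero λ′}} k →
  fromℤ (+ ∏! (replicate 4 k) * (- (+ 4 * λ′)) ^ (4 ℕ.* k)) ℚ.* periodTerm λ′ k ≡ fromℤ (+ ((4 ℕ.* k) !))
denominator*periodTerm λ′ k = begin
  fromℤ (+ ∏! (replicate 4 k) * (- (+ 4 * λ′)) ^ (4 ℕ.* k)) ℚ.* (N ℚ.* J⁻³ ℚ.* L⁻¹ Defs.^ (4 ℕ.* k))
    ≡⟨ cong (ℚ._* (N ℚ.* J⁻³ ℚ.* L⁻¹ Defs.^ (4 ℕ.* k))) expand ⟩
  J ℚ.* J³ ℚ.* (q ℚ.* L^) ℚ.* (N ℚ.* J⁻³ ℚ.* L⁻¹ Defs.^ (4 ℕ.* k))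
    ≡⟨ regroup J J³ q L^ N J⁻³ (L⁻¹ Defs.^ (4 ℕ.* k)) ⟩
  N ℚ.* (J ℚ.* q) ℚ.* (J³ ℚ.* J⁻³) ℚ.* (L^ ℚ.* L⁻¹ Defs.^ (4 ℕ.* k))
    ≡⟨ cong₂ (λ a b → N ℚ.* (J ℚ.* q) ℚ.* a ℚ.* b) (ℚ.*-inverseʳ J³)
         (trans (sym (^-distribʳ-*-ℚ L L⁻¹ (4 ℕ.* k))) (trans (cong (Defs._^ (4 ℕ.* k)) (ℚ.*-inverseʳ L)) (^-zeroˡ-ℚ (4 ℕ.* k)))) ⟩
  N ℚ.* (J ℚ.* q) ℚ.* 1ℚ ℚ.* 1ℚ
    ≡⟨ trans (ℚ.*-identityʳ _) (ℚ.*-identityʳ _) ⟩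
  N ℚ.* (J ℚ.* q)
    ≡⟨ numerator≡ k ⟩
  fromℤ (+ ((4 ℕ.* k) !)) ∎
  where
  open ≡-Reasoning
  instance
    _ = ℕ.m^n≢0 (k !) 3 {{k ℕ.!≢0}}
    _ = fromℤ-nonZero (+ ((k !) ℕ.^ 3))
    _ = fromℤ-nonZero λ′
  N = numerator k
  J = fromℤ (+ (k !))
  J³ = fromℤ (+ ((k !) ℕ.^ 3))
  J⁻³ = 1/ J³
  L = fromℤ λ′
  L⁻¹ = 1/ L
  L^ = L Defs.^ (4 ℕ.* k)
  q = fromℤ (- + 4) Defs.^ (4 ℕ.* k)
  expand : fromℤ (+ ∏! (replicate 4 k) * (- (+ 4 * λ′)) ^ (4 ℕ.* k)) ≡ J ℚ.* J³ ℚ.* (q ℚ.* L^)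
  expand = trans (fromℤ-* (+ ∏! (replicate 4 k)) ((- (+ 4 * λ′)) ^ (4 ℕ.* k))) (cong₂ ℚ._*_
    -- `∏! (replicate 4 k)` unfolds to `k !` times its cube; the cube cancels against the period
    -- term and the remaining `k !` feeds `numerator≡`.
    (fromℤ-pos-* (k !) ((k !) ℕ.^ 3))
    (trans (fromℤ-^ (- (+ 4 * λ′)) (4 ℕ.* k)) (trans
      (cong (Defs._^ (4 ℕ.* k)) (trans (cong fromℤ (ℤ.neg-distribˡ-* (+ 4) λ′)) (fromℤ-* (- + 4) λ′)))
      (^-distribʳ-*-ℚ (fromℤ (- + 4)) L (4 ℕ.* k)))))
  regroup : ∀ a b c d e f g →
    a ℚ.* b ℚ.* (c ℚ.* d) ℚ.* (e ℚ.* f ℚ.* g) ≡ e ℚ.* (a ℚ.* c) ℚ.* (b ℚ.* f) ℚ.* (d ℚ.* g)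
  regroup = solve 7 (λ a b c d e f g →
    a :* b :* (c :* d) :* (e :* f :* g) := e :* (a :* c) :* (b :* f) :* (d :* g)) refl
    where open +-*-Solver

module Localisation (n : ℕ) (p-prime : Prime (suc n)) where

  open PrimeField n p-prime

  private
    p : ℕ
    p = suc n

  -- The congruence of z and q modulo p ℤ₍ₚ₎ with the denominator cleared.
  record _≈ℚ_ (z : ℤ) (q : ℚ) : Set where
    constructor cleared
    field
      {denominator} : ℤ
      quotient      : ℤ
      p∤denominator : ¬ + p ∣ denominator
      equality      : fromℤ denominator ℚ.* (fromℤ z ℚ.- q) ≡ fromℤ (quotient * + p)

  fromℤ-- : ∀ x y → fromℤ (x - y) ≡ fromℤ x ℚ.- fromℤ y
  fromℤ-- x y = begin
    fromℤ (x - y)                               ≡⟨ lemma (fromℤ (x - y)) (fromℤ y) ⟩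
    fromℤ (x - y) ℚ.+ fromℤ y ℚ.- fromℤ y       ≡⟨ cong (ℚ._- fromℤ y) (fromℤ-+ (x - y) y) ⟨
    fromℤ (x - y + y) ℚ.- fromℤ y               ≡⟨ cong (λ z → fromℤ z ℚ.- fromℤ y) (lemma′ x y) ⟩
    fromℤ x ℚ.- fromℤ y                         ∎
    where
    open ≡-Reasoning
    lemma : ∀ a b → a ≡ a ℚ.+ b ℚ.- b
    lemma = solve 2 (λ a b → a := a :+ b :- b) refl
      where open +-*-Solver
    lemma′ : ∀ x y → x - y + y ≡ x
    lemma′ = solve-∀

  -- The passage from integer congruences to ℚ: for q = N/D, the number D (M - q) is the integer D M
  -- - N.
  fraction≈ : ∀ {D N M q} → ¬ + p ∣ D → fromℤ D ℚ.* q ≡ fromℤ N → D * M ≈ N → M ≈ℚ q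
  fraction≈ {D} {N} {M} {q} p∤D Dq≡N (mk (divides r eq)) = cleared r p∤D (begin
    fromℤ D ℚ.* (fromℤ M ℚ.- q)               ≡⟨ distrib (fromℤ D) (fromℤ M) q ⟩
    fromℤ D ℚ.* fromℤ M ℚ.- fromℤ D ℚ.* q     ≡⟨ cong₂ ℚ._-_ (sym (fromℤ-* D M)) Dq≡N ⟩
    fromℤ (D * M) ℚ.- fromℤ N                 ≡⟨ fromℤ-- (D * M) N ⟨
    fromℤ (D * M - N)                         ≡⟨ cong fromℤ eq ⟩
    fromℤ (r * + p)                           ∎)
    where
    open ≡-Reasoning
    distrib : ∀ a b c → a ℚ.* (b ℚ.- c) ≡ a ℚ.* b ℚ.- a ℚ.* c
    distrib = solve 3 (λ a b c → a :* (b :- c) := a :* b :- a :* c) refl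
      where open +-*-Solver

  ≈ℚ-+ : ∀ {x y q r} → x ≈ℚ q → y ≈ℚ r → (x + y) ≈ℚ (q ℚ.+ r)
  ≈ℚ-+ {x} {y} {q} {r} (cleared {D} s p∤D eq) (cleared {E} t p∤E eq′) = cleared (E * s + D * t) (p∤x*y p∤D p∤E) (begin
    fromℤ (D * E) ℚ.* (fromℤ (x + y) ℚ.- (q ℚ.+ r))
      ≡⟨ cong₂ (λ a b → a ℚ.* (b ℚ.- (q ℚ.+ r))) (fromℤ-* D E) (fromℤ-+ x y) ⟩
    fromℤ D ℚ.* fromℤ E ℚ.* (fromℤ x ℚ.+ fromℤ y ℚ.- (q ℚ.+ r))
      ≡⟨ regroup (fromℤ D) (fromℤ E) (fromℤ x) (fromℤ y) q r ⟩
    fromℤ E ℚ.* (fromℤ D ℚ.* (fromℤ x ℚ.- q)) ℚ.+ fromℤ D ℚ.* (fromℤ E ℚ.* (fromℤ y ℚ.- r))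
      ≡⟨ cong₂ (λ a b → fromℤ E ℚ.* a ℚ.+ fromℤ D ℚ.* b) eq eq′ ⟩
    fromℤ E ℚ.* fromℤ (s * + p) ℚ.+ fromℤ D ℚ.* fromℤ (t * + p)
      ≡⟨ cong₂ ℚ._+_ (fromℤ-* E (s * + p)) (fromℤ-* D (t * + p)) ⟨
    fromℤ (E * (s * + p)) ℚ.+ fromℤ (D * (t * + p))
      ≡⟨ fromℤ-+ (E * (s * + p)) (D * (t * + p)) ⟨
    fromℤ (E * (s * + p) + D * (t * + p))
      ≡⟨ cong fromℤ (factor E s D t (+ p)) ⟩
    fromℤ ((E * s + D * t) * + p) ∎)
    where
    open ≡-Reasoning
    regroup : ∀ d e x y q r →
      d ℚ.* e ℚ.* (x ℚ.+ y ℚ.- (q ℚ.+ r)) ≡ e ℚ.* (d ℚ.* (x ℚ.- q)) ℚ.+ d ℚ.* (e ℚ.* (y ℚ.- r))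
    regroup = solve 6 (λ d e x y q r →
      d :* e :* (x :+ y :- (q :+ r)) := e :* (d :* (x :- q)) :+ d :* (e :* (y :- r))) refl
      where open +-*-Solver
    factor : ∀ e s d t p → e * (s * p) + d * (t * p) ≡ (e * s + d * t) * p
    factor = solve-∀

  ≈⇒≈ℚ : ∀ {x y} → x ≈ y → x ≈ℚ fromℤ y
  ≈⇒≈ℚ {x} {y} x≈y = fraction≈ p∤1 (ℚ.*-identityˡ (fromℤ y)) (≈-trans (≡⇒≈ (ℤ.*-identityˡ x)) x≈y)

  -- Writing `x` as `(x - y) + y` reduces this to additivity, with `x - y` congruent to 0.
  ≈-≈ℚ-trans : ∀ {x y q} → x ≈ y → y ≈ℚ q → x ≈ℚ q
  ≈-≈ℚ-trans {x} {y} {q} (mk (divides r eq)) y≈q = subst (_≈ℚ q) (lemma x y)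
    (subst ((x - y + y) ≈ℚ_) (ℚ.+-identityˡ q) (≈ℚ-+ (≈⇒≈ℚ (∣⇒≈0 (divides r eq))) y≈q))
    where
    lemma : ∀ x y → x - y + y ≡ x
    lemma = solve-∀

  ∑≈ℚ : ∀ {f : ℕ → ℤ} {g : ℕ → ℚ} ks → (∀ {k} → k ∈ ks → f k ≈ℚ g k) → ∑ ks f ≈ℚ foldr ℚ._+_ 0ℚ (map g ks)
  ∑≈ℚ []       eq = ≈⇒≈ℚ (≈-refl {0ℤ})
  ∑≈ℚ (k ∷ ks) eq = ≈ℚ-+ (eq (here refl)) (∑≈ℚ ks (eq ∘ there))

  -- If `p` divided the reduced denominator, D u = N v would force it to divide the numerator u as
  -- well, against coprimality.
  fraction∈ℤ₍ₚ₎ : ∀ {D N} q → ¬ + p ∣ D → fromℤ D ℚ.* q ≡ fromℤ N → q ∈ℤ₍ p ₎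
  fraction∈ℤ₍ₚ₎ {D} {N} q@(mkℚ u v-1 coprime) p∤D Dq≡N p∣v =
    [ p∤D , (λ p∣u → ℕ.<⇒≢ 1<p (sym (Coprimality.recompute coprime (∣⇒∣ᵤ p∣u , p∣v)))) ]′ (p∣x*y⇒p∣x⊎p∣y D u p∣Du)
    where
    cross : D * u * 1ℤ ≡ N * + (1 ℕ.* suc v-1)
    cross with ℚᵘ.≃-trans (ℚᵘ.≃-sym (ℚᵘ.≃-trans (ℚ.toℚᵘ-homo-* (fromℤ D) q) (ℚᵘ.*-congʳ {toℚᵘ q} (toℚᵘ-fromℤ D))))
                 (ℚᵘ.≃-trans (ℚᵘ.≃-reflexive (cong toℚᵘ Dq≡N)) (toℚᵘ-fromℤ N))
    ... | *≡* eq = eq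
    p∣Du : + p ∣ D * u
    p∣Du = subst (+ p ∣_) (trans (cong (λ v → N * + v) (sym (ℕ.*-identityˡ (suc v-1)))) (trans (sym cross) (ℤ.*-identityʳ (D * u))))
      (∣n⇒∣m*n N (∣ᵤ⇒∣ p∣v))

  ≈ℚ⇒modℤ₍ₚ₎ : ∀ {z q} → z ≈ℚ q → fromℤ z ≡ q [modℤ₍ p ₎]
  ≈ℚ⇒modℤ₍ₚ₎ {z} {q} (cleared {D} r p∤D eq) =
    -- The witness is r/D, obtained by dividing the cleared equality by `D`.
    w , fraction∈ℤ₍ₚ₎ {N = r} w p∤D D*w≡r , (begin
    fromℤ z ℚ.- q                                            ≡⟨ ℚ.*-identityˡ _ ⟨
    1ℚ ℚ.* (fromℤ z ℚ.- q)                                   ≡⟨ cong (ℚ._* (fromℤ z ℚ.- q)) (ℚ.*-inverseˡ (fromℤ D)) ⟨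
    D⁻¹ ℚ.* fromℤ D ℚ.* (fromℤ z ℚ.- q)                      ≡⟨ ℚ.*-assoc D⁻¹ (fromℤ D) _ ⟩
    D⁻¹ ℚ.* (fromℤ D ℚ.* (fromℤ z ℚ.- q))                    ≡⟨ cong (D⁻¹ ℚ.*_) (trans eq (fromℤ-* r (+ p))) ⟩
    D⁻¹ ℚ.* (fromℤ r ℚ.* fromℤ (+ p))                        ≡⟨ regroup D⁻¹ (fromℤ r) (fromℤ (+ p)) ⟩
    fromℤ (+ p) ℚ.* (fromℤ r ℚ.* D⁻¹)                        ∎)
    where
    open ≡-Reasoning
    instance
      _ = ∤⇒nonZero p∤D
      _ = fromℤ-nonZero D
    D⁻¹ = 1/ fromℤ D
    w = fromℤ r ℚ.* D⁻¹
    D*w≡r : fromℤ D ℚ.* w ≡ fromℤ r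
    D*w≡r = trans (swap (fromℤ D) (fromℤ r) D⁻¹) (trans (cong (fromℤ r ℚ.*_) (ℚ.*-inverseʳ (fromℤ D))) (ℚ.*-identityʳ (fromℤ r)))
      where
      swap : ∀ a b c → a ℚ.* (b ℚ.* c) ≡ b ℚ.* (a ℚ.* c)
      swap = solve 3 (λ a b c → a :* (b :* c) := b :* (a :* c)) refl
        where open +-*-Solver
    regroup : ∀ a b c → a ℚ.* (b ℚ.* c) ≡ c ℚ.* (b ℚ.* a)
    regroup = solve 3 (λ a b c → a :* (b :* c) := c :* (b :* a)) refl
      where open +-*-Solver

-- The congruence for the trace of Frobenius

p∤4 : ∀ {p} → Prime p → p % 4 ≡ 1 → ¬ + p ∣ + 4
p∤4 {0} p-prime _ _ = ¬prime[0] p-prime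
p∤4 {1} p-prime _ _ = ¬prime[1] p-prime
p∤4 {2} _ () _
p∤4 {3} _ () _
p∤4 {4} _ () _
p∤4 {suc (suc (suc (suc (suc _))))} _ _ p∣4 with ℕ.∣⇒≤ (∣⇒∣ᵤ p∣4)
... | s≤s (s≤s (s≤s (s≤s ())))

theorem4 : (p : ℕ) → Prime p → p % 4 ≡ 1 → (λ′ : ℤ) → (p∤λ : ¬ (+ p ∣ λ′)) →
    fromℤ (frobeniusTrace p λ′) ≡ truncatedPeriod λ′ {{∤⇒nonZero p∤λ}} p [modℤ₍ p ₎]
theorem4 zero    p-prime _     λ′ p∤λ = contradiction p-prime ¬prime[0]
theorem4 (suc n) p-prime p%4≡1 λ′ p∤λ = ≈ℚ⇒modℤ₍ₚ₎ (≈-≈ℚ-trans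
  (≈-trans frobeniusTrace≈ (∑-form^n≈diagonal 3 c))
  -- Both sums run over k < p and agree term by term, each pair through the fraction (4k)! /
  -- `denominator k`.
  (∑≈ℚ (upTo (suc n)) (λ {k} k∈ → fraction≈ {D = denominator p∤c k} (p∤denominator p∤c (∈-upTo⁻ k∈))
    (denominator*periodTerm λ′ {{∤⇒nonZero p∤λ}} k) (denominator*coefficient p∤c k))))
  where
  open PrimeField n p-prime
  open Hypersurface n p-prime
  open Dwork n p-prime λ′
  open Coefficient n p-prime
  open Localisation n p-prime
  c : ℤ
  c = - (+ 4 * λ′)
  -- Both 4 and λ are units modulo `p`, hence so is c, as Fermat and the denominators c⁴ᵏ require.
  p∤c : ¬ + suc n ∣ c
  p∤c p∣c = p∤x*y (p∤4 p-prime p%4≡1) p∤λ (subst (+ suc n ∣_) (ℤ.neg-involutive (+ 4 * λ′)) (∣m⇒∣-m p∣c))
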